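{- Let $G$ be a connected simple graph with $n=|V(G)|$ vertices and minimum degree $\delta=\delta(G)$, and let $k\in(0,n)$ be a real number with $\delta\le\frac{n-k}{2}$. Each of the following holds. (i) If $q_{1}(G)<\frac{2\delta n}{n-k}$, then $\mu_{f}(G)>\frac{n-k}{2}$. (ii) If $q_{1}(\overline{G})<2(\delta+k-1)$, then $\mu_{f}(G)>\frac{n-k}{2}$.
   Context: Graphs are finite, simple and undirected. $\overline{G}$ is the complement of $G$. For a graph $H$ with adjacency matrix $A(H)$ and diagonal degree matrix $D(H)$, the $Q$-index $q_1(H)$ is the largest eigenvalue of $D(H)+A(H)$. A fractional matching of $G$ is a function $f:E(G)\to[0,1]$ such that for every vertex $v$ the sum of $f(e)$ over all edges $e$ incident with $v$ is at most $1$. The fractional matching number is $\mu_f(G)=\max\{\sum_{e\in E(G)}f(e): f \text{ is a fractional matching of } G\}$. -}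

module Defs where

open import Algebra.Bundles using (CommutativeRing)
open import Algebra.Definitions using (Congruent₁)
open import Data.Bool.Base using (Bool; true; false; not; _∧_)
open import Data.Bool.Properties using (∧-zeroʳ) renaming (_≟_ to _≟ᵇ_)
open import Data.Fin.Base as Fin using (Fin)
open import Data.Fin.Properties as Finₚ using ()
open import Data.Fin.Subset using (Subset; ∣_∣)
open import Data.Nat.Base as ℕ using (ℕ)
open import Data.Product.Base using (_×_; _,_; ∃; ∃-syntax)
open import Data.Sum.Base using (_⊎_)
open import Data.Vec.Base using (tabulate)
open import Level using (Level; _⊔_; suc)
open import Relation.Binary.Construct.Closure.ReflexiveTransitive using (Star)
open import Relation.Binary.Core using (Rel)
import Relation.Binary.Construct.StrictToNonStrict as StrictToNonStrict
open import Relation.Binary.PropositionalEquality using (_≡_; refl; cong; cong₂; trans; sym)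
open import Relation.Binary.Structures using (IsStrictTotalOrder)
open import Relation.Nullary.Decidable using (Dec; yes; no; _×-dec_; _⊎-dec_; ⌊_⌋)
open import Relation.Nullary.Negation using (¬_; contradiction)

-- The library has no real numbers, so ℝ is given by its usual classical
-- axioms: a Dedekind-complete (linearly) ordered field.  With excluded
-- middle these axioms are satisfiable, by a structure that is unique up
-- to isomorphism.
-- The inverse is total, and 0# ⁻¹ is unspecified.
record Reals (c ℓ₁ ℓ₂ : Level) : Set (suc (c ⊔ ℓ₁ ⊔ ℓ₂)) where
  field
    commutativeRing : CommutativeRing c ℓ₁

  open CommutativeRing commutativeRing public

  infix  4 _<_
  infix  8 _⁻¹
  infixl 7 _/_

  field
    _<_                : Rel Carrier ℓ₂
    isStrictTotalOrder : IsStrictTotalOrder _≈_ _<_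
    _⁻¹                : Carrier → Carrier
    ⁻¹-cong            : Congruent₁ _≈_ _⁻¹
    ⁻¹-inverseʳ        : ∀ x → ¬ (x ≈ 0#) → x * x ⁻¹ ≈ 1#
    1≉0                : ¬ (1# ≈ 0#)
    +-monoˡ-<          : ∀ {x y} z → x < y → x + z < y + z
    *-pos              : ∀ {x y} → 0# < x → 0# < y → 0# < x * y

  open StrictToNonStrict _≈_ _<_ public using (_≤_)

  _/_ : Carrier → Carrier → Carrier
  x / y = x * y ⁻¹

  IsUpperBound : (Carrier → Set (c ⊔ ℓ₁ ⊔ ℓ₂)) → Carrier → Set (c ⊔ ℓ₁ ⊔ ℓ₂)
  IsUpperBound P u = ∀ x → P x → x ≤ u

  field
    complete : (P : Carrier → Set (c ⊔ ℓ₁ ⊔ ℓ₂)) → ∃ P → ∃ (IsUpperBound P) →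
               ∃[ s ] IsUpperBound P s × (∀ u → IsUpperBound P u → s ≤ u)

record Graph (n : ℕ) : Set where
  field
    adj        : Fin n → Fin n → Bool
    adj-sym    : ∀ u v → adj u v ≡ adj v u
    adj-irrefl : ∀ v → adj v v ≡ false

open Graph public

module _ {n : ℕ} where

  complement : Graph n → Graph n
  complement G = record
    { adj        = λ u v → not (adj G u v) ∧ not ⌊ u Finₚ.≟ v ⌋
    ; adj-sym    = λ u v → cong₂ _∧_ (cong not (adj-sym G u v)) (cong not (≟-sym u v))
    ; adj-irrefl = λ v → trans (cong (λ b → not (adj G v v) ∧ not b) (≟-diag v))
                               (∧-zeroʳ (not (adj G v v)))
    }
    where
    ≟-sym : ∀ (u v : Fin n) → ⌊ u Finₚ.≟ v ⌋ ≡ ⌊ v Finₚ.≟ u ⌋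
    ≟-sym u v with u Finₚ.≟ v | v Finₚ.≟ u
    ... | yes _   | yes _   = refl
    ... | no _    | no _    = refl
    ... | yes u≡v | no v≢u  = contradiction (sym u≡v) v≢u
    ... | no u≢v  | yes v≡u = contradiction (sym v≡u) u≢v

    ≟-diag : ∀ (v : Fin n) → ⌊ v Finₚ.≟ v ⌋ ≡ true
    ≟-diag v with v Finₚ.≟ v
    ... | yes _  = refl
    ... | no v≢v = contradiction refl v≢v

  Connected : Graph n → Set
  Connected G = ∀ u v → Star (λ x y → adj G x y ≡ true) u v

  neighbourhood : Graph n → Fin n → Subset n
  neighbourhood G v = tabulate (adj G v)

  degree : Graph n → Fin n → ℕ
  degree G v = ∣ neighbourhood G v ∣

  IsMinDegree : Graph n → ℕ → Set
  IsMinDegree G δ = (∃[ v ] degree G v ≡ δ) × (∀ v → δ ℕ.≤ degree G v)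

  -- Each undirected edge is represented once, with its smaller endpoint
  -- first; both fields of IsEdge are proof-irrelevant.
  IsEdge : Graph n → Fin n → Fin n → Set
  IsEdge G u v = u Fin.< v × adj G u v ≡ true

  isEdge? : ∀ G u v → Dec (IsEdge G u v)
  isEdge? G u v = (u Finₚ.<? v) ×-dec (adj G u v ≟ᵇ true)

  record Edge (G : Graph n) : Set where
    constructor edge
    field
      end₁ end₂ : Fin n
      isEdge    : IsEdge G end₁ end₂

  Incident : {G : Graph n} → Fin n → Edge G → Set
  Incident v e = v ≡ Edge.end₁ e ⊎ v ≡ Edge.end₂ e

  incident? : {G : Graph n} (v : Fin n) (e : Edge G) → Dec (Incident v e)
  incident? v e = (v Finₚ.≟ Edge.end₁ e) ⊎-dec (v Finₚ.≟ Edge.end₂ e)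

module OverReals {c ℓ₁ ℓ₂ : Level} (ℝ : Reals c ℓ₁ ℓ₂) where

  open Reals ℝ hiding (refl; trans; sym)
  open import Algebra.Properties.Semiring.Mult semiring
    using () renaming (_×_ to _×ℕ_)
  open import Algebra.Properties.Semiring.Sum semiring using (sum-syntax)

  ι : ℕ → Carrier
  ι m = m ×ℕ 1#

  -- The value on a witness if there is one, and 0 otherwise.
  when : ∀ {a} {A : Set a} → Dec A → (A → Carrier) → Carrier
  when (yes a) x = x a
  when (no _)  x = 0#

  module _ {n : ℕ} where

    Matrix : Set c
    Matrix = Fin n → Fin n → Carrier

    IsEigenvalue : Matrix → Carrier → Set (c ⊔ ℓ₁)
    IsEigenvalue M q = ∃ λ (x : Fin n → Carrier) →
      (∃[ i ] ¬ (x i ≈ 0#)) × (∀ i → (∑[ j < n ] (M i j * x j)) ≈ q * x i)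

    IsLargestEigenvalue : Matrix → Carrier → Set (c ⊔ ℓ₁ ⊔ ℓ₂)
    IsLargestEigenvalue M q = IsEigenvalue M q × (∀ p → IsEigenvalue M p → p ≤ q)

    adjacencyMatrix : Graph n → Matrix
    adjacencyMatrix G i j = when (adj G i j ≟ᵇ true) λ _ → 1#

    degreeMatrix : Graph n → Matrix
    degreeMatrix G i j = when (i Finₚ.≟ j) λ _ → ι (degree G i)

    IsQIndex : Graph n → Carrier → Set (c ⊔ ℓ₁ ⊔ ℓ₂)
    IsQIndex G = IsLargestEigenvalue λ i j → degreeMatrix G i j + adjacencyMatrix G i j

    edgeSum : (G : Graph n) → (Edge G → Carrier) → Carrier
    edgeSum G f = ∑[ u < n ] ∑[ v < n ] when (isEdge? G u v) λ uv → f (edge u v uv)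

    record IsFractionalMatching (G : Graph n) (f : Edge G → Carrier) : Set (c ⊔ ℓ₁ ⊔ ℓ₂) where
      field
        nonneg   : ∀ e → 0# ≤ f e
        ≤-one    : ∀ e → f e ≤ 1#
        atVertex : ∀ v → edgeSum G (λ e → when (incident? v e) λ _ → f e) ≤ 1#

    IsFractionalMatchingNumber : Graph n → Carrier → Set (c ⊔ ℓ₁ ⊔ ℓ₂)
    IsFractionalMatchingNumber G m =
      (∃[ f ] IsFractionalMatching G f × m ≈ edgeSum G f) ×
      (∀ f → IsFractionalMatching G f → edgeSum G f ≤ m)

module Submission where

open import Defs
open import Algebra.Solver.Ring.AlmostCommutativeRing
  using (fromCommutativeRing; _-Raw-AlmostCommutative⟶_)
import Algebra.Solver.Ring as RingSolver
open import Axiom.UniquenessOfIdentityProofs using (module Decidable⇒UIP)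
open import Data.Bool.Base using (Bool; true; false; not; _∧_)
open import Data.Bool.Properties using () renaming (_≟_ to _≟ᵇ_)
open import Data.Empty using (⊥)
open import Data.Fin.Base using (Fin; zero; suc)
import Data.Fin.Properties as Fin
open import Data.Fin.Subset using () renaming (∣_∣ to ∣_∣ˢ)
open import Data.Integer.Base as ℤ using (ℤ; +_; -[1+_]; _⊖_; _◃_; sign; ∣_∣)
import Data.Integer.Properties as ℤ
open import Data.Maybe.Base using (map)
open import Data.Nat.Base as ℕ using (ℕ; zero; suc)
open import Data.Product.Base using (_×_; _,_; ∃-syntax; proj₁; proj₂)
import Data.Sign.Base as Sign
open import Data.Sum.Base using (_⊎_; inj₁; inj₂; [_,_]′)
open import Data.Vec.Base using (tabulate)
open import Data.Vec.Functional using (Vector; _∷_)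
open import Level using (Level; _⊔_; Lift; lift)
open import Relation.Binary.Bundles using (StrictPartialOrder)
import Relation.Binary.Construct.StrictToNonStrict as NonStrict
open import Relation.Binary.Definitions using (Decidable; Transitive; tri<; tri≈; tri>)
open import Relation.Binary.PropositionalEquality.Core as ≡ using (_≡_)
import Relation.Binary.Reasoning.Setoid as SetoidReasoning
import Relation.Binary.Reasoning.StrictPartialOrder as StrictPartialOrderReasoning
open import Relation.Binary.Structures using (IsStrictTotalOrder)
open import Relation.Nullary.Decidable
  using (Dec; yes; no; does; dec-true; dec⇒maybe; ¬¬-excluded-middle)
open import Relation.Nullary.Negation using (¬_; contradiction)

-- If μ_f ≤ (n − k)/2, alternating walks from the unsaturated vertices of an
-- optimal fractional matching give disjoint sets a and b, where b contains
-- every neighbour of a and |a| − |b| = n − 2 μ_f ≥ k.  Then a is independent,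
-- |b| ≥ δ, and test vectors constant on a and on b bound the Q-indices from
-- below: the edges between a and b give q₁(G) ≥ δ(|a| + |b|)/|b|, and the
-- clique on a in the complement gives q₁ ≥ 2(|a| − 1).
--
-- That the Rayleigh quotients are bounded by the largest eigenvalue is proved
-- from completeness: by induction on Schur complements, a symmetric matrix is
-- either bounded below by a positive multiple of the identity or has a
-- nonpositive form value on a nonzero vector.

-- A vertex is put into a when one unit of load can be shifted from it to an unsaturated vertex, and
-- into b when load can be raised at it and at an unsaturated vertex together. Since edge values may
-- change by arbitrarily small amounts, a closed odd walk augments as well as a path does, so
-- blossoms never arise. Optimality makes a and b disjoint and saturates b; all weight at a goes to
-- b, all weight at b comes from a, and every vertex outside a is saturated. Counting loads then
-- gives |a| - |b| = n - 2 μ_f. Membership in a or b quantifies over real-valued functions, so the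
-- sets exist only under a double negation; this is harmless because the order on the reals is
-- decidable. The definition of the Q-index compares it with eigenvalues only, so a large Rayleigh
-- quotient has to be turned into an actual eigenvalue at least as large. Part (i) ends with (|a| +
-- |b|)/|b| ≥ 2n/(n - k), which follows from |a| + |b| ≤ n and |a| ≥ |b| + k; part (ii) with |a| ≥
-- |b| + k ≥ δ + k.

-- Integer coefficients for the ring solver.

module IntegerCoefficients {c ℓ₁ ℓ₂ : Level} (ℝ : Reals c ℓ₁ ℓ₂) where

  open Reals ℝ
  open import Algebra.Properties.Ring ring
  open import Algebra.Properties.AbelianGroup +-abelianGroup using (⁻¹-∙-comm)
  open import Algebra.Properties.CommutativeSemigroup +-commutativeSemigroup
    using () renaming (interchange to +-interchange)
  open import Algebra.Properties.CommutativeSemigroup *-commutativeSemigroup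
    using () renaming (interchange to *-interchange)
  open import Algebra.Properties.Semiring.Mult.TCOptimised semiring
    using () renaming (_×_ to _×ℕ_; ×-homo-+ to ×ℕ-homo-+; ×1-homo-* to ×ℕ1-homo-*; 1+× to 1+×ℕ)
  open import Relation.Binary.Reasoning.Setoid setoid

  -- The solver has to compare coefficients by computation, hence integers. These multiples satisfy
  -- `1 ×ℕ x = x` definitionally, so that `con (+ 1)` denotes `1#` itself.
  ⟦_⟧ : ℤ → Carrier
  ⟦ + n ⟧      = n ×ℕ 1#
  ⟦ -[1+ n ] ⟧ = - (suc n ×ℕ 1#)

  ⟦⊖⟧ : ∀ m n → ⟦ m ⊖ n ⟧ ≈ m ×ℕ 1# - n ×ℕ 1#
  ⟦⊖⟧ m       zero    = sym (trans (+-congˡ -0#≈0#) (+-identityʳ _))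
  ⟦⊖⟧ zero    (suc n) = sym (+-identityˡ _)
  ⟦⊖⟧ (suc m) (suc n) = begin
    ⟦ suc m ⊖ suc n ⟧                   ≡⟨ ≡.cong ⟦_⟧ (ℤ.[1+m]⊖[1+n]≡m⊖n m n) ⟩
    ⟦ m ⊖ n ⟧                           ≈⟨ ⟦⊖⟧ m n ⟩
    m ×ℕ 1# - n ×ℕ 1#                   ≈⟨ +-identityˡ _ ⟨
    0# + (m ×ℕ 1# - n ×ℕ 1#)            ≈⟨ +-congʳ (-‿inverseʳ 1#) ⟨
    (1# - 1#) + (m ×ℕ 1# - n ×ℕ 1#)     ≈⟨ +-interchange _ _ _ _ ⟩
    (1# + m ×ℕ 1#) + (- 1# - n ×ℕ 1#)   ≈⟨ +-congˡ (⁻¹-∙-comm _ _) ⟩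
    (1# + m ×ℕ 1#) - (1# + n ×ℕ 1#)     ≈⟨ +-cong (1+×ℕ m 1#) (-‿cong (1+×ℕ n 1#)) ⟨
    suc m ×ℕ 1# - suc n ×ℕ 1#           ∎

  ⟦⟧-homo-+ : ∀ i j → ⟦ i ℤ.+ j ⟧ ≈ ⟦ i ⟧ + ⟦ j ⟧
  ⟦⟧-homo-+ (+ m)      (+ n)      = ×ℕ-homo-+ 1# m n
  ⟦⟧-homo-+ (+ m)      (-[1+ n ]) = ⟦⊖⟧ m (suc n)
  ⟦⟧-homo-+ (-[1+ m ]) (+ n)      = trans (⟦⊖⟧ n (suc m)) (+-comm _ _)
  ⟦⟧-homo-+ (-[1+ m ]) (-[1+ n ]) = begin
    - (suc (suc (m ℕ.+ n)) ×ℕ 1#)       ≡⟨ ≡.cong (λ k → ⟦ k ⟧) (ℤ.neg-distrib-+ (+ suc m) (+ suc n)) ⟨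
    - ((suc m ℕ.+ suc n) ×ℕ 1#)         ≈⟨ -‿cong (×ℕ-homo-+ 1# (suc m) (suc n)) ⟩
    - (suc m ×ℕ 1# + suc n ×ℕ 1#)       ≈⟨ ⁻¹-∙-comm _ _ ⟨
    - (suc m ×ℕ 1#) - suc n ×ℕ 1#       ∎

  ⟦_⟧ˢ : Sign.Sign → Carrier
  ⟦ Sign.+ ⟧ˢ = 1#
  ⟦ Sign.- ⟧ˢ = - 1#

  ⟦◃⟧ : ∀ s n → ⟦ s ◃ n ⟧ ≈ ⟦ s ⟧ˢ * n ×ℕ 1#
  ⟦◃⟧ s      zero    = sym (zeroʳ _)
  ⟦◃⟧ Sign.+ (suc n) = sym (*-identityˡ _)
  ⟦◃⟧ Sign.- (suc n) = sym (-1*x≈-x _)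

  ⟦⟧-sign-abs : ∀ i → ⟦ i ⟧ ≈ ⟦ sign i ⟧ˢ * ∣ i ∣ ×ℕ 1#
  ⟦⟧-sign-abs (+ n)      = sym (*-identityˡ _)
  ⟦⟧-sign-abs (-[1+ n ]) = sym (-1*x≈-x _)

  ⟦⟧ˢ-homo-* : ∀ s t → ⟦ s Sign.* t ⟧ˢ ≈ ⟦ s ⟧ˢ * ⟦ t ⟧ˢ
  ⟦⟧ˢ-homo-* Sign.+ t      = sym (*-identityˡ _)
  ⟦⟧ˢ-homo-* Sign.- Sign.+ = sym (*-identityʳ _)
  ⟦⟧ˢ-homo-* Sign.- Sign.- = sym (trans (-1*x≈-x _) (-‿involutive 1#))

  ⟦⟧-homo-* : ∀ i j → ⟦ i ℤ.* j ⟧ ≈ ⟦ i ⟧ * ⟦ j ⟧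
  ⟦⟧-homo-* i j = begin
    ⟦ sign i Sign.* sign j ◃ ∣ i ∣ ℕ.* ∣ j ∣ ⟧                             ≈⟨ ⟦◃⟧ (sign i Sign.* sign j) (∣ i ∣ ℕ.* ∣ j ∣) ⟩
    ⟦ sign i Sign.* sign j ⟧ˢ * (∣ i ∣ ℕ.* ∣ j ∣) ×ℕ 1#                    ≈⟨ *-cong (⟦⟧ˢ-homo-* (sign i) (sign j)) (×ℕ1-homo-* ∣ i ∣ ∣ j ∣) ⟩
    (⟦ sign i ⟧ˢ * ⟦ sign j ⟧ˢ) * (∣ i ∣ ×ℕ 1# * ∣ j ∣ ×ℕ 1#)              ≈⟨ *-interchange _ _ _ _ ⟩
    (⟦ sign i ⟧ˢ * ∣ i ∣ ×ℕ 1#) * (⟦ sign j ⟧ˢ * ∣ j ∣ ×ℕ 1#)              ≈⟨ *-cong (⟦⟧-sign-abs i) (⟦⟧-sign-abs j) ⟨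
    ⟦ i ⟧ * ⟦ j ⟧                                                          ∎

  ⟦⟧-homo‿- : ∀ i → ⟦ ℤ.- i ⟧ ≈ - ⟦ i ⟧
  ⟦⟧-homo‿- (+ zero)    = sym -0#≈0#
  ⟦⟧-homo‿- (+ (suc n)) = refl
  ⟦⟧-homo‿- (-[1+ n ])  = sym (-‿involutive _)

  homomorphism : ℤ.+-*-rawRing -Raw-AlmostCommutative⟶ fromCommutativeRing commutativeRing
  homomorphism = record
    { ⟦_⟧    = ⟦_⟧
    ; +-homo = ⟦⟧-homo-+
    ; *-homo = ⟦⟧-homo-*
    ; -‿homo = ⟦⟧-homo‿-
    ; 0-homo = refl
    ; 1-homo = refl
    }

  open RingSolver ℤ.+-*-rawRing (fromCommutativeRing commutativeRing) homomorphism
    (λ i j → map (λ i≡j → reflexive (≡.cong ⟦_⟧ i≡j)) (dec⇒maybe (i ℤ.≟ j))) public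
    using (solve; _:=_; _:+_; _:*_; _:-_; :-_; con)

-- Ordered-field arithmetic, small positive parameters and finite sums.

module OrderedField {c ℓ₁ ℓ₂ : Level} (ℝ : Reals c ℓ₁ ℓ₂) where

  open Reals ℝ public hiding (zero)
  open OverReals ℝ public
  open IntegerCoefficients ℝ public using (solve; _:=_; _:+_; _:*_; _:-_; :-_; con)
  open IsStrictTotalOrder isStrictTotalOrder public
    using (compare; _<?_; _≟_; <-resp-≈; <-respʳ-≈; <-respˡ-≈; isStrictPartialOrder)
    renaming (trans to <-trans; irrefl to <-irrefl)
  open import Algebra.Properties.Semiring.Sum semiring public
    using (sum-syntax; sum-cong-≋; sum-replicate; sum-replicate-zero; ∑-distrib-+; ∑-comm; *-distribˡ-sum)
  private module ≤ = NonStrict _≈_ _<_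
  module ≈-Reasoning = SetoidReasoning setoid

  strictPartialOrder : StrictPartialOrder c ℓ₁ ℓ₂
  strictPartialOrder = record { isStrictPartialOrder = isStrictPartialOrder }

  module ≤-Reasoning = StrictPartialOrderReasoning strictPartialOrder

  _≤?_ : Decidable _≤_
  _≤?_ = ≤.decidable′ compare

  ≤-refl : ∀ {x} → x ≤ x
  ≤-refl = inj₂ refl

  ≤-trans : Transitive _≤_
  ≤-trans = ≤.trans isEquivalence <-resp-≈ <-trans

  ≤-antisym : ∀ {x y} → x ≤ y → y ≤ x → x ≈ y
  ≤-antisym = ≤.antisym isEquivalence <-trans <-irrefl

  <-≤-trans : ∀ {x y z} → x < y → y ≤ z → x < z
  <-≤-trans = ≤.<-≤-trans <-trans <-respʳ-≈

  ≤-<-trans : ∀ {x y z} → x ≤ y → y < z → x < z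
  ≤-<-trans = ≤.≤-<-trans sym <-trans <-respˡ-≈

  ≤-respʳ-≈ : ∀ {x y z} → y ≈ z → x ≤ y → x ≤ z
  ≤-respʳ-≈ y≈z x≤y = ≤-trans x≤y (inj₂ y≈z)

  ≤-respˡ-≈ : ∀ {x y z} → x ≈ y → x ≤ z → y ≤ z
  ≤-respˡ-≈ x≈y x≤z = ≤-trans (inj₂ (sym x≈y)) x≤z

  ≤⇒≯ : ∀ {x y} → x ≤ y → ¬ (y < x)
  ≤⇒≯ x≤y y<x = <-irrefl refl (≤-<-trans x≤y y<x)

  ≮⇒≥ : ∀ {x y} → ¬ (x < y) → y ≤ x
  ≮⇒≥ {x} {y} x≮y with compare x y
  ... | tri< x<y _ _ = contradiction x<y x≮y
  ... | tri≈ _ x≈y _ = inj₂ (sym x≈y)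
  ... | tri> _ _ y<x = inj₁ y<x

  ≰⇒> : ∀ {x y} → ¬ (x ≤ y) → y < x
  ≰⇒> {x} {y} x≰y with compare x y
  ... | tri< x<y _ _ = contradiction (inj₁ x<y) x≰y
  ... | tri≈ _ x≈y _ = contradiction (inj₂ x≈y) x≰y
  ... | tri> _ _ y<x = y<x

  +-monoˡ-≤ : ∀ z {x y} → x ≤ y → x + z ≤ y + z
  +-monoˡ-≤ z (inj₁ x<y) = inj₁ (+-monoˡ-< z x<y)
  +-monoˡ-≤ z (inj₂ x≈y) = inj₂ (+-congʳ x≈y)

  +-monoʳ-≤ : ∀ z {x y} → x ≤ y → z + x ≤ z + y
  +-monoʳ-≤ z x≤y = ≤-respʳ-≈ (+-comm _ _) (≤-respˡ-≈ (+-comm _ _) (+-monoˡ-≤ z x≤y))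

  +-mono-≤ : ∀ {w x y z} → w ≤ x → y ≤ z → w + y ≤ x + z
  +-mono-≤ w≤x y≤z = ≤-trans (+-monoˡ-≤ _ w≤x) (+-monoʳ-≤ _ y≤z)

  x<y⇒0<y-x : ∀ {x y} → x < y → 0# < y - x
  x<y⇒0<y-x {x} x<y = <-respˡ-≈ (-‿inverseʳ x) (+-monoˡ-< (- x) x<y)

  x≤y⇒0≤y-x : ∀ {x y} → x ≤ y → 0# ≤ y - x
  x≤y⇒0≤y-x {x} x≤y = ≤-respˡ-≈ (-‿inverseʳ x) (+-monoˡ-≤ (- x) x≤y)

  y-x+x≈y : ∀ x y → (y - x) + x ≈ y
  y-x+x≈y = solve 2 (λ x y → (y :- x) :+ x := y) refl

  0≤y-x⇒x≤y : ∀ {x y} → 0# ≤ y - x → x ≤ y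
  0≤y-x⇒x≤y {x} {y} 0≤y-x =
    ≤-respʳ-≈ (y-x+x≈y x y) (≤-respˡ-≈ (+-identityˡ x) (+-monoˡ-≤ x 0≤y-x))

  0<y-x⇒x<y : ∀ {x y} → 0# < y - x → x < y
  0<y-x⇒x<y {x} {y} 0<y-x =
    <-respʳ-≈ (y-x+x≈y x y) (<-respˡ-≈ (+-identityˡ x) (+-monoˡ-< x 0<y-x))

  +-nonNeg : ∀ {x y} → 0# ≤ x → 0# ≤ y → 0# ≤ x + y
  +-nonNeg 0≤x 0≤y = ≤-respˡ-≈ (+-identityˡ 0#) (+-mono-≤ 0≤x 0≤y)

  +-nonNeg-pos : ∀ {x y} → 0# ≤ x → 0# < y → 0# < x + y
  +-nonNeg-pos {x} {y} 0≤x 0<y =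
    <-≤-trans 0<y (≤-respˡ-≈ (+-identityˡ y) (+-monoˡ-≤ y 0≤x))

  *-nonNeg : ∀ {x y} → 0# ≤ x → 0# ≤ y → 0# ≤ x * y
  *-nonNeg (inj₁ 0<x) (inj₁ 0<y) = inj₁ (*-pos 0<x 0<y)
  *-nonNeg (inj₁ 0<x) (inj₂ 0≈y) = inj₂ (trans (sym (zeroʳ _)) (*-congˡ 0≈y))
  *-nonNeg (inj₂ 0≈x) 0≤y        = inj₂ (trans (sym (zeroˡ _)) (*-congʳ 0≈x))

  *-monoˡ-≤ : ∀ {z x y} → 0# ≤ z → x ≤ y → z * x ≤ z * y
  *-monoˡ-≤ {z} {x} {y} 0≤z x≤y = 0≤y-x⇒x≤y (≤-respʳ-≈
    (solve 3 (λ z x y → z :* (y :- x) := z :* y :- z :* x) refl z x y)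
    (*-nonNeg 0≤z (x≤y⇒0≤y-x x≤y)))

  *-monoˡ-< : ∀ {z x y} → 0# < z → x < y → z * x < z * y
  *-monoˡ-< {z} {x} {y} 0<z x<y = 0<y-x⇒x<y (<-respʳ-≈
    (solve 3 (λ z x y → z :* (y :- x) := z :* y :- z :* x) refl z x y)
    (*-pos 0<z (x<y⇒0<y-x x<y)))

  *-cancelˡ-≤ : ∀ {z x y} → 0# < z → z * x ≤ z * y → x ≤ y
  *-cancelˡ-≤ 0<z zx≤zy = ≮⇒≥ λ y<x → ≤⇒≯ zx≤zy (*-monoˡ-< 0<z y<x)

  *-monoʳ-≤ : ∀ {x y z} → 0# ≤ z → x ≤ y → x * z ≤ y * z
  *-monoʳ-≤ 0≤z x≤y = ≤-respʳ-≈ (*-comm _ _) (≤-respˡ-≈ (*-comm _ _) (*-monoˡ-≤ 0≤z x≤y))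

  *-cancelʳ-≤ : ∀ {x y z} → 0# < z → x * z ≤ y * z → x ≤ y
  *-cancelʳ-≤ 0<z xz≤yz = *-cancelˡ-≤ 0<z (≤-respʳ-≈ (*-comm _ _) (≤-respˡ-≈ (*-comm _ _) xz≤yz))

  neg-pos : ∀ {x} → x < 0# → 0# < - x
  neg-pos x<0 = <-respʳ-≈ (+-identityˡ _) (x<y⇒0<y-x x<0)

  sq-nonNeg : ∀ x → 0# ≤ x * x
  sq-nonNeg x with 0# ≤? x
  ... | yes 0≤x = *-nonNeg 0≤x 0≤x
  ... | no  0≰x = inj₁ (<-respʳ-≈ (solve 1 (λ x → :- x :* :- x := x :* x) refl x)
                          (*-pos (neg-pos (≰⇒> 0≰x)) (neg-pos (≰⇒> 0≰x))))

  0<1 : 0# < 1#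
  0<1 with ≤-respʳ-≈ (*-identityʳ 1#) (sq-nonNeg 1#)
  ... | inj₁ 0<1 = 0<1
  ... | inj₂ 0≈1 = contradiction (sym 0≈1) 1≉0

  0≤1 : 0# ≤ 1#
  0≤1 = inj₁ 0<1

  0<1+1 : 0# < 1# + 1#
  0<1+1 = +-nonNeg-pos 0≤1 0<1

  2-cancel-≤ : ∀ {x y} → x + x ≤ y + y → x ≤ y
  2-cancel-≤ {x} {y} h = *-cancelˡ-≤ 0<1+1 (≤-respʳ-≈ (double y) (≤-respˡ-≈ (double x) h))
    where
    double : ∀ z → z + z ≈ (1# + 1#) * z
    double = solve 1 (λ z → z :+ z := (con (+ 1) :+ con (+ 1)) :* z) refl

  x*y≤x²+y² : ∀ x y → x * y ≤ x * x + y * y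
  x*y≤x²+y² x y = *-cancelˡ-≤ 0<1+1 (0≤y-x⇒x≤y (≤-respʳ-≈
    (solve 2 (λ x y → (x :- y) :* (x :- y) :+ (x :* x :+ y :* y)
                   := (con (+ 1) :+ con (+ 1)) :* (x :* x :+ y :* y) :- (con (+ 1) :+ con (+ 1)) :* (x :* y))
       refl x y)
    (+-nonNeg (sq-nonNeg (x - y)) (+-nonNeg (sq-nonNeg x) (sq-nonNeg y)))))

  ι-mono : ∀ {i j} → i ℕ.≤ j → ι i ≤ ι j
  ι-mono {j = zero}  ℕ.z≤n       = ≤-refl
  ι-mono {j = suc j} ℕ.z≤n       = +-nonNeg 0≤1 (ι-mono {j = j} ℕ.z≤n)
  ι-mono             (ℕ.s≤s i≤j) = +-monoʳ-≤ 1# (ι-mono i≤j)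

  pos⇒≉0 : ∀ {x} → 0# < x → ¬ (x ≈ 0#)
  pos⇒≉0 0<x x≈0 = <-irrefl (sym x≈0) 0<x

  sq≤0⇒≈0 : ∀ {x} → x * x ≤ 0# → x ≈ 0#
  sq≤0⇒≈0 {x} xx≤0 with x ≟ 0#
  ... | yes x≈0 = x≈0
  ... | no  x≉0 = contradiction (begin
    x                 ≈⟨ *-identityʳ x ⟨
    x * 1#            ≈⟨ *-congˡ (⁻¹-inverseʳ x x≉0) ⟨
    x * (x * x ⁻¹)    ≈⟨ *-assoc _ _ _ ⟨
    x * x * x ⁻¹      ≈⟨ *-congʳ (≤-antisym xx≤0 (sq-nonNeg x)) ⟩
    0# * x ⁻¹         ≈⟨ zeroˡ _ ⟩
    0#                ∎) x≉0
    where open ≈-Reasoning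

  ⁻¹-pos : ∀ {x} → 0# < x → 0# < x ⁻¹
  ⁻¹-pos {x} 0<x = ≰⇒> λ x⁻¹≤0 → ≤⇒≯
    (≤-respʳ-≈ (zeroʳ x) (≤-respˡ-≈ (⁻¹-inverseʳ x (pos⇒≉0 0<x)) (*-monoˡ-≤ (inj₁ 0<x) x⁻¹≤0)))
    0<1

  /-cancel : ∀ {x} → 0# < x → ∀ y → x * (y / x) ≈ y
  /-cancel {x} 0<x y = begin
    x * (y * x ⁻¹)   ≈⟨ solve 3 (λ x y z → x :* (y :* z) := y :* (x :* z)) refl x y (x ⁻¹) ⟩
    y * (x * x ⁻¹)   ≈⟨ *-congˡ (⁻¹-inverseʳ x (pos⇒≉0 0<x)) ⟩
    y * 1#           ≈⟨ *-identityʳ y ⟩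
    y                ∎
    where open ≈-Reasoning

  -- Limits as t tends to 0 from above. Asking for every small t, and not for one, lets finitely
  -- many conditions on a step size be met by a single t.
  Eventually : ∀ {p} → (Carrier → Set p) → Set (c ⊔ ℓ₁ ⊔ ℓ₂ ⊔ p)
  Eventually P = ∃[ ε ] 0# < ε × (∀ t → 0# < t → t ≤ ε → P t)

  module _ {p : Level} {P : Carrier → Set p} where

    always : (∀ t → 0# < t → P t) → Eventually P
    always p = 1# , 0<1 , λ t 0<t _ → p t 0<t

    witness : Eventually P → ∃[ t ] 0# < t × P t
    witness (ε , 0<ε , p) = ε , 0<ε , p ε 0<ε ≤-refl

  eventually-× : ∀ {p q} {P : Carrier → Set p} {Q : Carrier → Set q} →
                 Eventually P → Eventually Q → Eventually (λ t → P t × Q t)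
  eventually-× (ε , 0<ε , p) (ε′ , 0<ε′ , q) with ε ≤? ε′
  ... | yes ε≤ε′ = ε , 0<ε , λ t 0<t t≤ε → p t 0<t t≤ε , q t 0<t (≤-trans t≤ε ε≤ε′)
  ... | no  ε≰ε′ = ε′ , 0<ε′ , λ t 0<t t≤ε′ →
    p t 0<t (≤-trans t≤ε′ (inj₁ (≰⇒> ε≰ε′))) , q t 0<t t≤ε′

  eventually-∀ : ∀ {p n} {P : Fin n → Carrier → Set p} →
                 (∀ i → Eventually (P i)) → Eventually (λ t → ∀ i → P i t)
  eventually-∀ {n = zero}  ps = always λ _ _ ()
  eventually-∀ {n = suc n} ps
    with ε , 0<ε , q ← eventually-× (ps zero) (eventually-∀ (λ i → ps (suc i))) =
    ε , 0<ε , λ t 0<t t≤ε → λ where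
      zero    → proj₁ (q t 0<t t≤ε)
      (suc i) → proj₂ (q t 0<t t≤ε) i

  -- A threshold is needed only when b < 0 < a, and it is then the zero of a + t b. A tight
  -- constraint (a = 0) survives only if its slope b is nonnegative.
  eventually-+* : ∀ {a b} → 0# ≤ a → 0# ≤ b ⊎ 0# < a → Eventually (λ t → 0# ≤ a + t * b)
  eventually-+* {a} {b} 0≤a h with 0# ≤? b
  ... | yes 0≤b = always λ t 0<t → +-nonNeg 0≤a (*-nonNeg (inj₁ 0<t) 0≤b)
  ... | no  0≰b with h
  ...   | inj₁ 0≤b = contradiction 0≤b 0≰b
  ...   | inj₂ 0<a = a / - b , *-pos 0<a (⁻¹-pos 0<-b) , λ t _ t≤a/-b → ≤-respʳ-≈
    (solve 3 (λ a b t → a :- (:- b) :* t := a :+ t :* b) refl a b t)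
    (x≤y⇒0≤y-x (≤-respʳ-≈ (/-cancel 0<-b a) (*-monoˡ-≤ (inj₁ 0<-b) t≤a/-b)))
    where 0<-b = neg-pos (≰⇒> 0≰b)

  when-1-nonNeg : ∀ {a} {A : Set a} (d : Dec A) → 0# ≤ when d λ _ → 1#
  when-1-nonNeg (yes _) = 0≤1
  when-1-nonNeg (no _)  = ≤-refl

  𝟙 : Bool → Carrier
  𝟙 b = when (b ≟ᵇ true) λ _ → 1#

  𝟙-nonNeg : ∀ b → 0# ≤ 𝟙 b
  𝟙-nonNeg b = when-1-nonNeg (b ≟ᵇ true)

  [_≡_] : ∀ {n} → Fin n → Fin n → Carrier
  [ i ≡ j ] = when (i Fin.≟ j) λ _ → 1#

  ∑-mono : ∀ {n} {f g : Fin n → Carrier} → (∀ i → f i ≤ g i) → ∑[ i < n ] f i ≤ ∑[ i < n ] g i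
  ∑-mono {zero}  f≤g = ≤-refl
  ∑-mono {suc n} f≤g = +-mono-≤ (f≤g zero) (∑-mono (λ i → f≤g (suc i)))

  ∑-nonNeg : ∀ {n} {f : Fin n → Carrier} → (∀ i → 0# ≤ f i) → 0# ≤ ∑[ i < n ] f i
  ∑-nonNeg {n} 0≤f = ≤-respˡ-≈ (sum-replicate-zero n) (∑-mono 0≤f)

  term≤∑ : ∀ {n} {f : Fin n → Carrier} → (∀ i → 0# ≤ f i) → ∀ j → f j ≤ ∑[ i < n ] f i
  term≤∑ 0≤f zero    = ≤-respˡ-≈ (+-identityʳ _) (+-monoʳ-≤ _ (∑-nonNeg (λ i → 0≤f (suc i))))
  term≤∑ 0≤f (suc j) = ≤-respˡ-≈ (+-identityˡ _) (+-mono-≤ (0≤f zero) (term≤∑ (λ i → 0≤f (suc i)) j))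

  ∑-kronecker : ∀ {n} i (x : Fin n → Carrier) → ∑[ j < n ] ([ i ≡ j ] * x j) ≈ x i
  ∑-kronecker {suc n} zero x = begin
    1# * x zero + ∑[ j < n ] (0# * x (suc j))   ≈⟨ +-cong (*-identityˡ _) (sum-cong-≋ (λ j → zeroˡ (x (suc j)))) ⟩
    x zero + ∑[ j < n ] 0#                      ≈⟨ +-congˡ (sum-replicate-zero n) ⟩
    x zero + 0#                                 ≈⟨ +-identityʳ _ ⟩
    x zero                                      ∎
    where open ≈-Reasoning
  ∑-kronecker {suc n} (suc i) x = begin
    0# * x zero + ∑[ j < n ] ([ suc i ≡ suc j ] * x (suc j))   ≈⟨ +-cong (zeroˡ _) (sum-cong-≋ (λ j → *-congʳ (suc-≡ j))) ⟩
    0# + ∑[ j < n ] ([ i ≡ j ] * x (suc j))                    ≈⟨ +-identityˡ _ ⟩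
    ∑[ j < n ] ([ i ≡ j ] * x (suc j))                         ≈⟨ ∑-kronecker i (λ j → x (suc j)) ⟩
    x (suc i)                                                  ∎
    where
    open ≈-Reasoning
    suc-≡ : ∀ j → [ suc i ≡ suc j ] ≈ [ i ≡ j ]
    suc-≡ j with i Fin.≟ j
    ... | yes _ = refl
    ... | no _  = refl

  ∑-linear : ∀ {n} t (f g : Fin n → Carrier) →
             ∑[ i < n ] (f i + t * g i) ≈ ∑[ i < n ] f i + t * ∑[ i < n ] g i
  ∑-linear t f g = trans (∑-distrib-+ f (λ i → t * g i)) (+-congˡ (sym (*-distribˡ-sum t g)))

  ∑∑-distribˡ : ∀ {m n} t (f : Fin m → Fin n → Carrier) →
                t * ∑[ i < m ] ∑[ j < n ] f i j ≈ ∑[ i < m ] ∑[ j < n ] (t * f i j)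
  ∑∑-distribˡ {m} {n} t f = trans (*-distribˡ-sum t (λ i → ∑[ j < n ] f i j))
                                  (sum-cong-≋ λ i → *-distribˡ-sum t (f i))

  ∑∑-symmetrise : ∀ {n} (f : Fin n → Fin n → Carrier) →
                  ∑[ i < n ] ∑[ j < n ] (f i j + f j i) ≈
                  ∑[ i < n ] ∑[ j < n ] f i j + ∑[ i < n ] ∑[ j < n ] f i j
  ∑∑-symmetrise {n} f = begin
    ∑[ i < n ] ∑[ j < n ] (f i j + f j i)
      ≈⟨ sum-cong-≋ (λ i → ∑-distrib-+ (f i) (λ j → f j i)) ⟩
    ∑[ i < n ] (∑[ j < n ] f i j + ∑[ j < n ] f j i)
      ≈⟨ ∑-distrib-+ (λ i → ∑[ j < n ] f i j) (λ i → ∑[ j < n ] f j i) ⟩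
    ∑[ i < n ] ∑[ j < n ] f i j + ∑[ i < n ] ∑[ j < n ] f j i
      ≈⟨ +-congˡ (∑-comm (λ i j → f j i)) ⟩
    ∑[ i < n ] ∑[ j < n ] f i j + ∑[ i < n ] ∑[ j < n ] f i j   ∎
    where open ≈-Reasoning

-- Quadratic forms of symmetric matrices and Rayleigh quotients.

module QuadraticForms {c ℓ₁ ℓ₂ : Level} (ℝ : Reals c ℓ₁ ℓ₂) where

  open OrderedField ℝ

  infix 5 ⟪_,_⟫
  infixr 8 _·_

  ⟪_,_⟫ : ∀ {n} → Vector Carrier n → Vector Carrier n → Carrier
  ⟪_,_⟫ {n} x y = ∑[ i < n ] (x i * y i)

  _·_ : ∀ {n} → Matrix {n} → Vector Carrier n → Vector Carrier n
  _·_ {n} A x i = ∑[ j < n ] (A i j * x j)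

  Symmetric : ∀ {n} → Matrix {n} → Set ℓ₁
  Symmetric A = ∀ i j → A i j ≈ A j i

  NonZero : ∀ {n} → Vector Carrier n → Set ℓ₁
  NonZero x = ∃[ i ] ¬ (x i ≈ 0#)

  -- The uniform margin ε is what allows an upper bound of the Rayleigh quotients to be lowered;
  -- positivity at each nonzero vector would not give this directly.
  PositiveDefinite : ∀ {n} → Matrix {n} → Set (c ⊔ ℓ₁ ⊔ ℓ₂)
  PositiveDefinite A = ∃[ ε ] 0# < ε × (∀ x → ε * ⟪ x , x ⟫ ≤ ⟪ x , A · x ⟫)

  PositiveSemidefinite : ∀ {n} → Matrix {n} → Set (c ⊔ ℓ₁ ⊔ ℓ₂)
  PositiveSemidefinite A = ∀ x → 0# ≤ ⟪ x , A · x ⟫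

  ⟪⟫-congʳ : ∀ {n} (x : Vector Carrier n) {y z : Vector Carrier n} →
             (∀ i → y i ≈ z i) → ⟪ x , y ⟫ ≈ ⟪ x , z ⟫
  ⟪⟫-congʳ x y≈z = sum-cong-≋ (λ i → *-congˡ (y≈z i))

  ⟪⟫-comm : ∀ {n} (x y : Vector Carrier n) → ⟪ x , y ⟫ ≈ ⟪ y , x ⟫
  ⟪⟫-comm x y = sum-cong-≋ (λ i → *-comm (x i) (y i))

  ⟪⟫-linearʳ : ∀ {n} (x : Vector Carrier n) t y z →
               ⟪ x , (λ i → y i + t * z i) ⟫ ≈ ⟪ x , y ⟫ + t * ⟪ x , z ⟫
  ⟪⟫-linearʳ x t y z = trans
    (sum-cong-≋ (λ i → solve 4 (λ x t y z → x :* (y :+ t :* z) := x :* y :+ t :* (x :* z))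
                         refl (x i) t (y i) (z i)))
    (∑-linear t (λ i → x i * y i) (λ i → x i * z i))

  ⟪⟫-linearˡ : ∀ {n} t (x y z : Vector Carrier n) →
               ⟪ (λ i → x i + t * y i) , z ⟫ ≈ ⟪ x , z ⟫ + t * ⟪ y , z ⟫
  ⟪⟫-linearˡ t x y z = trans (⟪⟫-comm _ z)
    (trans (⟪⟫-linearʳ z t x y) (+-cong (⟪⟫-comm z x) (*-congˡ (⟪⟫-comm z y))))

  ·-linear : ∀ {n} (A : Matrix {n}) t x y i →
             (A · (λ j → x j + t * y j)) i ≈ (A · x) i + t * (A · y) i
  ·-linear A t x y i = ⟪⟫-linearʳ (A i) t x y

  ·-selfAdjoint : ∀ {n} {A : Matrix {n}} → Symmetric A → ∀ x y → ⟪ x , A · y ⟫ ≈ ⟪ y , A · x ⟫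
  ·-selfAdjoint {n} {A} A-sym x y = begin
    ∑[ i < n ] (x i * ∑[ j < n ] (A i j * y j))     ≈⟨ sum-cong-≋ (λ i → *-distribˡ-sum (x i) (λ j → A i j * y j)) ⟩
    ∑[ i < n ] ∑[ j < n ] (x i * (A i j * y j))     ≈⟨ ∑-comm (λ i j → x i * (A i j * y j)) ⟩
    ∑[ j < n ] ∑[ i < n ] (x i * (A i j * y j))     ≈⟨ sum-cong-≋ (λ j → sum-cong-≋ (λ i → swap i j)) ⟩
    ∑[ j < n ] ∑[ i < n ] (y j * (A j i * x i))     ≈⟨ sum-cong-≋ (λ j → *-distribˡ-sum (y j) (λ i → A j i * x i)) ⟨
    ∑[ j < n ] (y j * ∑[ i < n ] (A j i * x i))     ∎
    where
    open ≈-Reasoning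
    swap : ∀ i j → x i * (A i j * y j) ≈ y j * (A j i * x i)
    swap i j = trans (solve 3 (λ x a y → x :* (a :* y) := y :* (a :* x)) refl (x i) (A i j) (y j))
                     (*-congˡ (*-congʳ (A-sym i j)))

  form-expand : ∀ {n} {A : Matrix {n}} → Symmetric A → ∀ t x y →
                let z = λ i → x i + t * y i in
                ⟪ z , A · z ⟫ ≈
                ⟪ x , A · x ⟫ + (t * (⟪ y , A · x ⟫ + ⟪ y , A · x ⟫) + t * t * ⟪ y , A · y ⟫)
  form-expand {n} {A} A-sym t x y = begin
    ⟪ z , A · z ⟫                                                     ≈⟨ ⟪⟫-congʳ z (·-linear A t x y) ⟩
    ⟪ z , (λ i → (A · x) i + t * (A · y) i) ⟫                         ≈⟨ ⟪⟫-linearʳ z t (A · x) (A · y) ⟩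
    ⟪ z , A · x ⟫ + t * ⟪ z , A · y ⟫                                 ≈⟨ +-cong (⟪⟫-linearˡ t x y (A · x)) (*-congˡ (⟪⟫-linearˡ t x y (A · y))) ⟩
    (⟪ x , A · x ⟫ + t * ⟪ y , A · x ⟫) + t * (⟪ x , A · y ⟫ + t * ⟪ y , A · y ⟫)
      ≈⟨ +-congˡ (*-congˡ (+-congʳ (·-selfAdjoint A-sym x y))) ⟩
    (⟪ x , A · x ⟫ + t * ⟪ y , A · x ⟫) + t * (⟪ y , A · x ⟫ + t * ⟪ y , A · y ⟫)
      ≈⟨ solve 4 (λ a b d t → (a :+ t :* b) :+ t :* (b :+ t :* d) := a :+ (t :* (b :+ b) :+ t :* t :* d))
           refl ⟪ x , A · x ⟫ ⟪ y , A · x ⟫ ⟪ y , A · y ⟫ t ⟩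
    ⟪ x , A · x ⟫ + (t * (⟪ y , A · x ⟫ + ⟪ y , A · x ⟫) + t * t * ⟪ y , A · y ⟫)   ∎
    where
    open ≈-Reasoning
    z = λ i → x i + t * y i

  norm-nonNeg : ∀ {n} (x : Vector Carrier n) → 0# ≤ ⟪ x , x ⟫
  norm-nonNeg x = ∑-nonNeg (λ i → sq-nonNeg (x i))

  norm≤0⇒≈0 : ∀ {n} (x : Vector Carrier n) → ⟪ x , x ⟫ ≤ 0# → ∀ i → x i ≈ 0#
  norm≤0⇒≈0 x xx≤0 i = sq≤0⇒≈0 (≤-trans (term≤∑ (λ j → sq-nonNeg (x j)) i) xx≤0)

  ⟪⟫-bounded : ∀ {n} (b : Vector Carrier n) →
               ∃[ K ] 0# ≤ K × (∀ x → ⟪ b , x ⟫ * ⟪ b , x ⟫ ≤ K * ⟪ x , x ⟫)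
  ⟪⟫-bounded {zero}  b = 0# , ≤-refl , λ x → inj₂ (trans (zeroˡ 0#) (sym (zeroˡ 0#)))
  ⟪⟫-bounded {suc n} b with K , 0≤K , bound ← ⟪⟫-bounded (λ i → b (suc i)) =
    (b₀ * b₀ + b₀ * b₀) + (K + K) ,
    +-nonNeg (+-nonNeg 0≤b₀² 0≤b₀²) (+-nonNeg 0≤K 0≤K) , λ x →
    let x₀ = x zero; x′ = λ i → x (suc i)
        N = ⟪ x′ , x′ ⟫; r = ⟪ (λ i → b (suc i)) , x′ ⟫
        h = x≤y⇒0≤y-x (bound x′)
    in 0≤y-x⇒x≤y (≤-respʳ-≈
      (solve 5 (λ b x K N r →
          ((b :* b :+ b :* b) :* N :+ (K :+ K) :* (x :* x))
            :+ (((K :* N :- r :* r) :+ (K :* N :- r :* r)) :+ (b :* x :- r) :* (b :* x :- r))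
          := ((b :* b :+ b :* b) :+ (K :+ K)) :* (x :* x :+ N) :- (b :* x :+ r) :* (b :* x :+ r))
        refl b₀ x₀ K N r)
      (+-nonNeg
        (+-nonNeg (*-nonNeg (+-nonNeg 0≤b₀² 0≤b₀²) (norm-nonNeg x′))
                  (*-nonNeg (+-nonNeg 0≤K 0≤K) (sq-nonNeg x₀)))
        (+-nonNeg (+-nonNeg h h) (sq-nonNeg (b₀ * x₀ - r)))))
    where
    b₀ = b zero
    0≤b₀² = sq-nonNeg b₀

  -- The size of B is irrelevant; it only has to show that the Rayleigh quotients have a supremum.
  form-bounded : ∀ {n} (A : Matrix {n}) → ∃[ B ] (∀ x → ⟪ x , A · x ⟫ ≤ B * ⟪ x , x ⟫)
  form-bounded {n} A = 1# + ∑[ i < n ] K i , λ x → begin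
    ⟪ x , A · x ⟫                                          ≤⟨ ∑-mono (λ i → x*y≤x²+y² (x i) ((A · x) i)) ⟩
    ∑[ i < n ] (x i * x i + (A · x) i * (A · x) i)         ≤⟨ ∑-mono (λ i → +-monoʳ-≤ (x i * x i)
                                                                (≤-respʳ-≈ (*-comm _ _) (proj₂ (proj₂ (⟪⟫-bounded (A i))) x))) ⟩
    ∑[ i < n ] (x i * x i + ⟪ x , x ⟫ * K i)               ≈⟨ ∑-linear ⟪ x , x ⟫ (λ i → x i * x i) K ⟩
    ⟪ x , x ⟫ + ⟪ x , x ⟫ * ∑[ i < n ] K i                 ≈⟨ solve 2 (λ N S → N :+ N :* S := (con (+ 1) :+ S) :* N) refl ⟪ x , x ⟫ (∑[ i < n ] K i) ⟩
    (1# + ∑[ i < n ] K i) * ⟪ x , x ⟫                      ∎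
    where
    open ≤-Reasoning
    K : Fin n → Carrier
    K i = proj₁ (⟪⟫-bounded (A i))

  form-basis : ∀ {n} (A : Matrix {n}) i → ⟪ [ i ≡_] , A · [ i ≡_] ⟫ ≈ A i i
  form-basis A i = begin
    ⟪ [ i ≡_] , A · [ i ≡_] ⟫   ≈⟨ ∑-kronecker i (A · [ i ≡_]) ⟩
    (A · [ i ≡_]) i             ≈⟨ ⟪⟫-comm (A i) [ i ≡_] ⟩
    ⟪ [ i ≡_] , A i ⟫           ≈⟨ ∑-kronecker i (A i) ⟩
    A i i                       ∎
    where open ≈-Reasoning

  module SchurComplement {n : ℕ} (A : Matrix {suc n}) (A-sym : Symmetric A) (0<a : 0# < A zero zero) where

    a a⁻¹ : Carrier
    a   = A zero zero
    a⁻¹ = a ⁻¹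

    b : Vector Carrier n
    b i = A zero (suc i)

    complementMatrix : Matrix {n}
    complementMatrix i j = A (suc i) (suc j) - a⁻¹ * (b i * b j)

    complement-sym : Symmetric complementMatrix
    complement-sym i j = +-cong (A-sym (suc i) (suc j)) (-‿cong (*-congˡ (*-comm (b i) (b j))))

    private
      A′ : Matrix {n}
      A′ i j = A (suc i) (suc j)

    form-complement : ∀ x → ⟪ x , complementMatrix · x ⟫ ≈ ⟪ x , A′ · x ⟫ - a⁻¹ * (⟪ b , x ⟫ * ⟪ b , x ⟫)
    form-complement x = begin
      ⟪ x , complementMatrix · x ⟫                                     ≈⟨ ⟪⟫-congʳ x row ⟩
      ⟪ x , (λ i → (A′ · x) i + (- (a⁻¹ * ⟪ b , x ⟫)) * b i) ⟫         ≈⟨ ⟪⟫-linearʳ x _ (A′ · x) b ⟩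
      ⟪ x , A′ · x ⟫ + (- (a⁻¹ * ⟪ b , x ⟫)) * ⟪ x , b ⟫               ≈⟨ +-congˡ (*-congˡ (⟪⟫-comm x b)) ⟩
      ⟪ x , A′ · x ⟫ + (- (a⁻¹ * ⟪ b , x ⟫)) * ⟪ b , x ⟫
        ≈⟨ solve 3 (λ F i β → F :+ (:- (i :* β)) :* β := F :- i :* (β :* β)) refl ⟪ x , A′ · x ⟫ a⁻¹ ⟪ b , x ⟫ ⟩
      ⟪ x , A′ · x ⟫ - a⁻¹ * (⟪ b , x ⟫ * ⟪ b , x ⟫)                   ∎
      where
      open ≈-Reasoning
      row : ∀ i → (complementMatrix · x) i ≈ (A′ · x) i + (- (a⁻¹ * ⟪ b , x ⟫)) * b i
      row i = begin
        ∑[ j < n ] ((A′ i j - a⁻¹ * (b i * b j)) * x j)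
          ≈⟨ sum-cong-≋ (λ j → solve 5 (λ A i bi bj x → (A :- i :* (bi :* bj)) :* x := A :* x :+ (:- (i :* bi)) :* (bj :* x))
               refl (A′ i j) a⁻¹ (b i) (b j) (x j)) ⟩
        ∑[ j < n ] (A′ i j * x j + (- (a⁻¹ * b i)) * (b j * x j))   ≈⟨ ∑-linear _ (λ j → A′ i j * x j) (λ j → b j * x j) ⟩
        (A′ · x) i + (- (a⁻¹ * b i)) * ⟪ b , x ⟫
          ≈⟨ +-congˡ (solve 3 (λ i bi β → (:- (i :* bi)) :* β := (:- (i :* β)) :* bi) refl a⁻¹ (b i) ⟪ b , x ⟫) ⟩
        (A′ · x) i + (- (a⁻¹ * ⟪ b , x ⟫)) * b i   ∎

    completeSquare : ∀ x → let x₀ = x zero; x′ = λ i → x (suc i); u = x₀ + a⁻¹ * ⟪ b , x′ ⟫ in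
                     ⟪ x , A · x ⟫ ≈ a * (u * u) + ⟪ x′ , complementMatrix · x′ ⟫
    completeSquare x = begin
      x₀ * (a * x₀ + β) + ⟪ x′ , (λ i → A (suc i) zero * x₀ + (A′ · x′) i) ⟫
        ≈⟨ +-congˡ (⟪⟫-congʳ x′ (λ i → trans (+-comm _ _) (+-congˡ (trans (*-comm _ _) (*-congˡ (A-sym (suc i) zero)))))) ⟩
      x₀ * (a * x₀ + β) + ⟪ x′ , (λ i → (A′ · x′) i + x₀ * b i) ⟫
        ≈⟨ +-congˡ (trans (⟪⟫-linearʳ x′ x₀ (A′ · x′) b) (+-congˡ (*-congˡ (⟪⟫-comm x′ b)))) ⟩
      x₀ * (a * x₀ + β) + (F + x₀ * β)
        -- To the solver `a⁻¹` is a free variable. The terms are grouped around an explicit factor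
        -- `1#`, which the next step replaces by `a * a⁻¹`; after that the square is a ring
        -- identity.
        ≈⟨ solve 5 (λ a i x β F → x :* (a :* x :+ β) :+ (F :+ x :* β)
                               := (con (+ 1) :* (x :* β :+ x :* β :+ i :* (β :* β)) :+ a :* (x :* x)) :+ (F :- i :* (β :* β)))
             refl a a⁻¹ x₀ β F ⟩
      (1# * (x₀ * β + x₀ * β + a⁻¹ * (β * β)) + a * (x₀ * x₀)) + (F - a⁻¹ * (β * β))
        ≈⟨ +-congʳ (+-congʳ (*-congʳ (⁻¹-inverseʳ a (pos⇒≉0 0<a)))) ⟨
      ((a * a⁻¹) * (x₀ * β + x₀ * β + a⁻¹ * (β * β)) + a * (x₀ * x₀)) + (F - a⁻¹ * (β * β))
        ≈⟨ +-cong (solve 4 (λ a i x β → (a :* i) :* (x :* β :+ x :* β :+ i :* (β :* β)) :+ a :* (x :* x)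
                                     := a :* ((x :+ i :* β) :* (x :+ i :* β)))
                     refl a a⁻¹ x₀ β)
                  (sym (form-complement x′)) ⟩
      a * ((x₀ + a⁻¹ * β) * (x₀ + a⁻¹ * β)) + ⟪ x′ , complementMatrix · x′ ⟫   ∎
      where
      open ≈-Reasoning
      x₀ = x zero
      x′ = λ i → x (suc i)
      β = ⟪ b , x′ ⟫
      F = ⟪ x′ , A′ · x′ ⟫

    -- With u the completed coordinate, x₀ = u - γ gives x₀² ≤ 2u² + 2γ² ≤ 2u² + 2LN. Hence ε(x₀² +
    -- N) ≤ 2εu² + ε(1 + 2L)N, and the two conditions on ε bound these terms by a u² and ε′N.
    positiveDefinite : PositiveDefinite complementMatrix → PositiveDefinite A
    positiveDefinite (ε′ , 0<ε′ , ε′-bound) with K , 0≤K , K-bound ← ⟪⟫-bounded b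
      with ε , 0<ε , 0≤a-2ε , 0≤ε′-ε[1+2L] ←
           witness (eventually-× (eventually-+* {b = - (1# + 1#)} (inj₁ 0<a) (inj₂ 0<a))
                                 (eventually-+* {b = - (1# + (a⁻¹ * a⁻¹ * K + a⁻¹ * a⁻¹ * K))} (inj₁ 0<ε′) (inj₂ 0<ε′))) =
      ε , 0<ε , bound
      where
      L = a⁻¹ * a⁻¹ * K

      module _ (x : Vector Carrier (suc n)) where
        x₀ = x zero
        x′ = λ i → x (suc i)
        N  = ⟪ x′ , x′ ⟫
        γ  = a⁻¹ * ⟪ b , x′ ⟫
        u  = x₀ + γ

        γ²≤LN : γ * γ ≤ L * N
        γ²≤LN = ≤-respʳ-≈ (sym (*-assoc (a⁻¹ * a⁻¹) K N)) (≤-respˡ-≈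
          (solve 2 (λ i β → i :* i :* (β :* β) := (i :* β) :* (i :* β)) refl a⁻¹ ⟪ b , x′ ⟫)
          (*-monoˡ-≤ (sq-nonNeg a⁻¹) (K-bound x′)))

        x₀²-bound : x₀ * x₀ ≤ (u * u + u * u) + (L * N + L * N)
        x₀²-bound = 0≤y-x⇒x≤y (≤-respʳ-≈
          (solve 3 (λ x γ m →
              ((m :- γ :* γ) :+ (m :- γ :* γ)) :+ ((x :+ γ) :+ γ) :* ((x :+ γ) :+ γ)
              := (((x :+ γ) :* (x :+ γ) :+ (x :+ γ) :* (x :+ γ)) :+ (m :+ m)) :- x :* x)
            refl x₀ γ (L * N))
          (+-nonNeg (+-nonNeg (x≤y⇒0≤y-x γ²≤LN) (x≤y⇒0≤y-x γ²≤LN)) (sq-nonNeg (u + γ))))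

        bound : ε * ⟪ x , x ⟫ ≤ ⟪ x , A · x ⟫
        bound = begin
          ε * (x₀ * x₀ + N)
            ≤⟨ *-monoˡ-≤ (inj₁ 0<ε) (+-monoˡ-≤ N x₀²-bound) ⟩
          ε * (((u * u + u * u) + (L * N + L * N)) + N)
            ≈⟨ solve 4 (λ ε U m N → ε :* (((U :+ U) :+ (m :+ m)) :+ N) := ε :* (U :+ U) :+ ε :* (N :+ (m :+ m)))
                 refl ε (u * u) (L * N) N ⟩
          ε * (u * u + u * u) + ε * (N + (L * N + L * N))
            ≤⟨ +-mono-≤
                 (0≤y-x⇒x≤y (≤-respʳ-≈
                   (solve 3 (λ a ε U → (a :+ ε :* (:- (con (+ 1) :+ con (+ 1)))) :* U := a :* U :- ε :* (U :+ U))
                     refl a ε (u * u))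
                   (*-nonNeg 0≤a-2ε (sq-nonNeg u))))
                 (0≤y-x⇒x≤y (≤-respʳ-≈
                   (solve 4 (λ d ε L N → (d :+ ε :* (:- (con (+ 1) :+ (L :+ L)))) :* N := d :* N :- ε :* (N :+ (L :* N :+ L :* N)))
                     refl ε′ ε L N)
                   (*-nonNeg 0≤ε′-ε[1+2L] (norm-nonNeg x′)))) ⟩
          a * (u * u) + ε′ * N
            ≤⟨ +-monoʳ-≤ (a * (u * u)) (ε′-bound x′) ⟩
          a * (u * u) + ⟪ x′ , complementMatrix · x′ ⟫
            ≈⟨ completeSquare x ⟨
          ⟪ x , A · x ⟫   ∎
          where open ≤-Reasoning

    -- The prepended coordinate makes the completed square vanish, so the form of A at the longer
    -- vector equals that of the Schur complement at x.
    extend : ∀ x → NonZero x → ⟪ x , complementMatrix · x ⟫ ≤ 0# →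
             ∃[ y ] NonZero y × ⟪ y , A · y ⟫ ≤ 0#
    extend x (i , xᵢ≉0) form≤0 = (- (a⁻¹ * ⟪ b , x ⟫)) ∷ x , (suc i , xᵢ≉0) , ≤-respˡ-≈ (begin
      ⟪ x , complementMatrix · x ⟫
        ≈⟨ solve 3 (λ a t F → F := a :* ((:- t :+ t) :* (:- t :+ t)) :+ F)
             refl a (a⁻¹ * ⟪ b , x ⟫) ⟪ x , complementMatrix · x ⟫ ⟩
      a * ((- (a⁻¹ * ⟪ b , x ⟫) + a⁻¹ * ⟪ b , x ⟫) * (- (a⁻¹ * ⟪ b , x ⟫) + a⁻¹ * ⟪ b , x ⟫))
        + ⟪ x , complementMatrix · x ⟫
        ≈⟨ completeSquare ((- (a⁻¹ * ⟪ b , x ⟫)) ∷ x) ⟨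
      ⟪ (- (a⁻¹ * ⟪ b , x ⟫)) ∷ x , A · ((- (a⁻¹ * ⟪ b , x ⟫)) ∷ x) ⟫   ∎) form≤0
      where open ≈-Reasoning

  -- The sign of the pivot decides: if it is nonpositive, the first basis vector is a witness; if it
  -- is positive, both alternatives lift from the Schur complement.
  positiveDefinite? : ∀ {n} (A : Matrix {n}) → Symmetric A →
                      PositiveDefinite A ⊎ ∃[ x ] NonZero x × ⟪ x , A · x ⟫ ≤ 0#
  positiveDefinite? {zero}  A _ = inj₁ (1# , 0<1 , λ _ → inj₂ (zeroʳ 1#))
  positiveDefinite? {suc n} A A-sym with 0# <? A zero zero
  ... | no  a≯0 = inj₂ ([ zero ≡_] , (zero , 1≉0) , ≤-respˡ-≈ (sym (form-basis A zero)) (≮⇒≥ a≯0))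
  ... | yes 0<a with positiveDefinite? complementMatrix complement-sym
    where open SchurComplement A A-sym 0<a
  ...   | inj₁ pd                = inj₁ (SchurComplement.positiveDefinite A A-sym 0<a pd)
  ...   | inj₂ (x , x≠0 , form≤0) = inj₂ (SchurComplement.extend A A-sym 0<a x x≠0 form≤0)

  -- A first-order argument: with w = A x of squared norm W > 0 and F the form at w, the form at x -
  -- t w is at most - 2tW + t²F. For small t this is at most - tW < 0, against semidefiniteness.
  semidefinite-kernel : ∀ {n} {A : Matrix {n}} → Symmetric A → PositiveSemidefinite A →
                        ∀ x → ⟪ x , A · x ⟫ ≤ 0# → ∀ i → (A · x) i ≈ 0#
  semidefinite-kernel {n} {A} A-sym psd x form≤0 = norm≤0⇒≈0 w (≮⇒≥ λ 0<W →
    let t , 0<t , 0≤W-tF = witness (eventually-+* {b = - F} (inj₁ 0<W) (inj₂ 0<W))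
        z = λ i → x i + (- t) * w i
        0≤form = ≤-respʳ-≈ (form-expand A-sym (- t) x w) (psd z)
    in ≤⇒≯ (0≤y-x⇒x≤y (≤-respʳ-≈
         (solve 4 (λ X W F t →
             (X :+ ((:- t) :* (W :+ W) :+ (:- t) :* (:- t) :* F))
               :+ (t :* (W :+ t :* (:- F)) :+ (con (+ 0) :- X))
             := con (+ 0) :- t :* W)
           refl ⟪ x , A · x ⟫ W F t)
         (+-nonNeg 0≤form (+-nonNeg (*-nonNeg (inj₁ 0<t) 0≤W-tF) (x≤y⇒0≤y-x form≤0)))))
       (*-pos 0<t 0<W))
    where
    w : Vector Carrier n
    w = A · x
    W = ⟪ w , w ⟫
    F = ⟪ w , A · w ⟫

  shift : ∀ {n} → Carrier → Matrix {n} → Matrix {n}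
  shift s M i j = - M i j + s * [ i ≡ j ]

  [≡]-sym : ∀ {n} (i j : Fin n) → [ i ≡ j ] ≈ [ j ≡ i ]
  [≡]-sym i j with i Fin.≟ j | j Fin.≟ i
  ... | yes _   | yes _   = refl
  ... | no _    | no _    = refl
  ... | yes i≡j | no j≢i  = contradiction (≡.sym i≡j) j≢i
  ... | no i≢j  | yes j≡i = contradiction (≡.sym j≡i) i≢j

  module _ {n : ℕ} (s : Carrier) (M : Matrix {n}) where

    shift-sym : Symmetric M → Symmetric (shift s M)
    shift-sym M-sym i j = +-cong (-‿cong (M-sym i j)) (*-congˡ ([≡]-sym i j))

    shift-· : ∀ x i → (shift s M · x) i ≈ s * x i - (M · x) i
    shift-· x i = begin
      ∑[ j < n ] ((- M i j + s * [ i ≡ j ]) * x j)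
        ≈⟨ sum-cong-≋ (λ j → solve 4 (λ m s δ x → ((:- m) :+ s :* δ) :* x := s :* (δ :* x) :+ (:- con (+ 1)) :* (m :* x))
             refl (M i j) s [ i ≡ j ] (x j)) ⟩
      ∑[ j < n ] (s * ([ i ≡ j ] * x j) + (- 1#) * (M i j * x j))   ≈⟨ ∑-linear (- 1#) (λ j → s * ([ i ≡ j ] * x j)) (λ j → M i j * x j) ⟩
      ∑[ j < n ] (s * ([ i ≡ j ] * x j)) + (- 1#) * (M · x) i
        ≈⟨ +-congʳ (trans (sym (*-distribˡ-sum s (λ j → [ i ≡ j ] * x j))) (*-congˡ (∑-kronecker i x))) ⟩
      s * x i + (- 1#) * (M · x) i   ≈⟨ solve 2 (λ a b → a :+ (:- con (+ 1)) :* b := a :- b) refl (s * x i) ((M · x) i) ⟩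
      s * x i - (M · x) i            ∎
      where open ≈-Reasoning

    shift-form : ∀ x → ⟪ x , shift s M · x ⟫ ≈ s * ⟪ x , x ⟫ - ⟪ x , M · x ⟫
    shift-form x = begin
      ⟪ x , shift s M · x ⟫                              ≈⟨ ⟪⟫-congʳ x (λ i → trans (shift-· x i)
                                                              (solve 3 (λ s x m → s :* x :- m := (:- m) :+ s :* x) refl s (x i) ((M · x) i))) ⟩
      ⟪ x , (λ i → - (M · x) i + s * x i) ⟫              ≈⟨ ⟪⟫-linearʳ x s (λ i → - (M · x) i) x ⟩
      ⟪ x , (λ i → - (M · x) i) ⟫ + s * ⟪ x , x ⟫        ≈⟨ +-congʳ (sum-cong-≋ (λ i →
                                                              solve 2 (λ x m → x :* (:- m) := (:- con (+ 1)) :* (x :* m)) refl (x i) ((M · x) i))) ⟩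
      ∑[ i < n ] ((- 1#) * (x i * (M · x) i)) + s * ⟪ x , x ⟫   ≈⟨ +-congʳ (*-distribˡ-sum (- 1#) (λ i → x i * (M · x) i)) ⟨
      (- 1#) * ⟪ x , M · x ⟫ + s * ⟪ x , x ⟫
        ≈⟨ solve 2 (λ f g → (:- con (+ 1)) :* f :+ g := g :- f) refl ⟪ x , M · x ⟫ (s * ⟪ x , x ⟫) ⟩
      s * ⟪ x , x ⟫ - ⟪ x , M · x ⟫                      ∎
      where open ≈-Reasoning

  -- The supremum s of the Rayleigh quotients is attained, since otherwise
  -- s I − M would be positive definite and s could be lowered; a maximiser
  -- is then an eigenvector for s.
  rayleigh : ∀ {n} {M : Matrix {n}} {q} → Symmetric M → IsLargestEigenvalue M q →
             ∀ x → ⟪ x , M · x ⟫ ≤ q * ⟪ x , x ⟫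
  rayleigh {n} {M} {q} M-sym (_ , q-largest) = fromPositiveNorm λ x 0<xx →
    let B , bound = form-bounded M
        -- A supremum requires an inhabited set; the vector of positive norm under consideration
        -- supplies its element.
        s , s-upper , s-least = complete Quotient (_ , quotient x 0<xx) (B , upperBound bound)
    in ≤-trans (s-rayleigh s s-upper s-least x) (*-monoʳ-≤ (inj₁ 0<xx) (s≤q s s-upper s-least))
    where
    fromPositiveNorm : ∀ {t} → (∀ x → 0# < ⟪ x , x ⟫ → ⟪ x , M · x ⟫ ≤ t * ⟪ x , x ⟫) →
                       ∀ x → ⟪ x , M · x ⟫ ≤ t * ⟪ x , x ⟫
    fromPositiveNorm {t} h x with 0# <? ⟪ x , x ⟫
    ... | yes 0<xx = h x 0<xx
    ... | no  0≮xx = inj₂ (begin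
      ⟪ x , M · x ⟫                 ≈⟨ sum-cong-≋ (λ i → trans (*-congʳ (x≈0 i)) (zeroˡ _)) ⟩
      ∑[ i < n ] 0#                 ≈⟨ sum-replicate-zero n ⟩
      0#                            ≈⟨ zeroʳ t ⟨
      t * 0#                        ≈⟨ *-congˡ (≤-antisym (≮⇒≥ 0≮xx) (norm-nonNeg x)) ⟨
      t * ⟪ x , x ⟫                 ∎)
      where
      open ≈-Reasoning
      x≈0 = norm≤0⇒≈0 x (≮⇒≥ 0≮xx)

    -- Everything below some Rayleigh quotient is included: the upper bounds stay the same and
    -- membership involves no division. `Lift` meets the universe level that `complete` expects.
    Quotient : Carrier → Set (c ⊔ ℓ₁ ⊔ ℓ₂)
    Quotient t = Lift (c ⊔ ℓ₁ ⊔ ℓ₂) (∃[ x ] 0# < ⟪ x , x ⟫ × t * ⟪ x , x ⟫ ≤ ⟪ x , M · x ⟫)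

    quotient-* : ∀ x → 0# < ⟪ x , x ⟫ → (⟪ x , M · x ⟫ / ⟪ x , x ⟫) * ⟪ x , x ⟫ ≈ ⟪ x , M · x ⟫
    quotient-* x 0<xx = trans (*-comm _ _) (/-cancel 0<xx _)

    quotient : ∀ x → 0# < ⟪ x , x ⟫ → Quotient (⟪ x , M · x ⟫ / ⟪ x , x ⟫)
    quotient x 0<xx = lift (x , 0<xx , inj₂ (quotient-* x 0<xx))

    upperBound : ∀ {t} → (∀ x → ⟪ x , M · x ⟫ ≤ t * ⟪ x , x ⟫) → IsUpperBound Quotient t
    upperBound h t (lift (x , 0<xx , t≤)) = *-cancelʳ-≤ 0<xx (≤-trans t≤ (h x))

    module _ (s : Carrier) (s-upper : IsUpperBound Quotient s)
             (s-least : ∀ u → IsUpperBound Quotient u → s ≤ u) where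

      s-rayleigh : ∀ x → ⟪ x , M · x ⟫ ≤ s * ⟪ x , x ⟫
      s-rayleigh = fromPositiveNorm λ x 0<xx → ≤-respˡ-≈ (quotient-* x 0<xx)
        (*-monoʳ-≤ (inj₁ 0<xx) (s-upper _ (quotient x 0<xx)))

      s≤q : s ≤ q
      s≤q with positiveDefinite? (shift s M) (shift-sym s M M-sym)
      ... | inj₁ (ε , 0<ε , ε-bound) = contradiction
        (s-least (s - ε) (upperBound λ x → 0≤y-x⇒x≤y (≤-respʳ-≈
          (solve 4 (λ s ε N F → s :* N :- F :- ε :* N := (s :- ε) :* N :- F) refl s ε ⟪ x , x ⟫ ⟪ x , M · x ⟫)
          (x≤y⇒0≤y-x (≤-respʳ-≈ (shift-form s M x) (ε-bound x))))))
        λ s≤s-ε → ≤⇒≯ s≤s-ε (0<y-x⇒x<y (<-respʳ-≈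
          (solve 2 (λ s ε → ε := s :- (s :- ε)) refl s ε) 0<ε))
      ... | inj₂ (x , x≠0 , form≤0) = q-largest s (x , x≠0 , λ i → begin
        (M · x) i                             ≈⟨ solve 2 (λ m y → m := y :- (y :- m)) refl ((M · x) i) (s * x i) ⟩
        s * x i - (s * x i - (M · x) i)       ≈⟨ +-congˡ (-‿cong (trans (sym (shift-· s M x i)) (kernel i))) ⟩
        s * x i - 0#                          ≈⟨ solve 1 (λ y → y :- con (+ 0) := y) refl (s * x i) ⟩
        s * x i                               ∎)
        where
        open ≈-Reasoning
        kernel = semidefinite-kernel (shift-sym s M M-sym)
          (λ y → ≤-respʳ-≈ (sym (shift-form s M y)) (x≤y⇒0≤y-x (s-rayleigh y))) x form≤0

-- Excluded middle holds under a double negation, and finitely many instances can be collected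
-- there. This supplies the characteristic functions of sets whose membership is not decidable.
¬¬-dec-∀ : ∀ {p n} {P : Fin n → Set p} → ¬ ¬ (∀ i → Dec (P i))
¬¬-dec-∀ {n = zero}  k = k λ ()
¬¬-dec-∀ {n = suc n} k = ¬¬-excluded-middle λ d → ¬¬-dec-∀ λ ds → k λ where
  zero    → d
  (suc i) → ds i

-- Fractional matchings, alternating walks and the deficiency count.

module FractionalMatchings {c ℓ₁ ℓ₂ : Level} (ℝ : Reals c ℓ₁ ℓ₂) {n : ℕ} (G : Graph n) where

  open OrderedField ℝ

  EdgeFunction : Set c
  EdgeFunction = Edge G → Carrier

  extend : EdgeFunction → Fin n → Fin n → Carrier
  extend f u v = when (isEdge? G u v) λ uv → f (edge u v uv)

  -- The symmetric matrix of f. At most one of the two terms is nonzero, because an edge is stored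
  -- with its smaller endpoint first.
  weight : EdgeFunction → Fin n → Fin n → Carrier
  weight f u v = extend f u v + extend f v u

  load : EdgeFunction → Fin n → Carrier
  load f v = edgeSum G λ e → when (incident? v e) λ _ → f e

  -- `isEdge?` returns a proof of its own, which has to be identified with the one stored in a given
  -- edge.
  IsEdge-irrelevant : ∀ {u v} (p q : IsEdge G u v) → p ≡ q
  IsEdge-irrelevant (u<v , uv) (u<v′ , uv′) =
    ≡.cong₂ _,_ (Fin.<-irrelevant u<v u<v′) (≡-irrelevant uv uv′)
    where open Decidable⇒UIP _≟ᵇ_ using (≡-irrelevant)

  extend-edge : ∀ f {u v} (uv : IsEdge G u v) → extend f u v ≡ f (edge u v uv)
  extend-edge f {u} {v} uv with isEdge? G u v
  ... | yes uv′ = ≡.cong (λ p → f (edge u v p)) (IsEdge-irrelevant uv′ uv)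
  ... | no ¬uv  = contradiction uv ¬uv

  extend-nonEdge : ∀ f {u v} → ¬ IsEdge G u v → extend f u v ≡ 0#
  extend-nonEdge f {u} {v} ¬uv with isEdge? G u v
  ... | yes uv = contradiction uv ¬uv
  ... | no _   = ≡.refl

  extend-linear : ∀ f t g u v → extend (λ e → f e + t * g e) u v ≈ extend f u v + t * extend g u v
  extend-linear f t g u v with isEdge? G u v
  ... | yes _ = refl
  ... | no _  = solve 1 (λ t → con (+ 0) := con (+ 0) :+ t :* con (+ 0)) refl t

  edgeSum-linear : ∀ f t g → edgeSum G (λ e → f e + t * g e) ≈ edgeSum G f + t * edgeSum G g
  edgeSum-linear f t g = trans
    (sum-cong-≋ λ u → trans (sum-cong-≋ (extend-linear f t g u)) (∑-linear t (extend f u) (extend g u)))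
    (∑-linear t (λ u → ∑[ v < n ] extend f u v) (λ u → ∑[ v < n ] extend g u v))

  extend-incident : ∀ f v u w → extend (λ e → when (incident? v e) λ _ → f e) u w ≈
                                [ v ≡ u ] * extend f u w + [ v ≡ w ] * extend f u w
  extend-incident f v u w with isEdge? G u w
  ... | no _ = solve 2 (λ a b → con (+ 0) := a :* con (+ 0) :+ b :* con (+ 0)) refl [ v ≡ u ] [ v ≡ w ]
  ... | yes uw with v Fin.≟ u | v Fin.≟ w
  ...   | yes v≡u | yes v≡w = contradiction (proj₁ uw) (Fin.<-irrefl (≡.trans (≡.sym v≡u) v≡w))
  ...   | yes _   | no _    = solve 1 (λ x → x := con (+ 1) :* x :+ con (+ 0) :* x) refl _
  ...   | no _    | yes _   = solve 1 (λ x → x := con (+ 0) :* x :+ con (+ 1) :* x) refl _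
  ...   | no _    | no _    = solve 1 (λ x → con (+ 0) := con (+ 0) :* x :+ con (+ 0) :* x) refl (f (edge u w uw))

  -- The edges at v split into those with v as smaller end and those with v as larger end, which are
  -- the two terms of `weight`.
  load≈∑weight : ∀ f v → load f v ≈ ∑[ w < n ] weight f v w
  load≈∑weight f v = begin
    load f v
      ≈⟨ sum-cong-≋ (λ u → trans (sum-cong-≋ (extend-incident f v u))
           (trans (∑-distrib-+ (λ w → [ v ≡ u ] * extend f u w) (λ w → [ v ≡ w ] * extend f u w))
                  (+-cong (sym (*-distribˡ-sum [ v ≡ u ] (extend f u))) (∑-kronecker v (extend f u))))) ⟩
    ∑[ u < n ] ([ v ≡ u ] * (∑[ w < n ] extend f u w) + extend f u v)
      ≈⟨ ∑-distrib-+ (λ u → [ v ≡ u ] * ∑[ w < n ] extend f u w) (λ u → extend f u v) ⟩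
    ∑[ u < n ] ([ v ≡ u ] * (∑[ w < n ] extend f u w)) + ∑[ u < n ] extend f u v
      ≈⟨ +-congʳ (∑-kronecker v (λ u → ∑[ w < n ] extend f u w)) ⟩
    ∑[ w < n ] extend f v w + ∑[ u < n ] extend f u v
      ≈⟨ ∑-distrib-+ (extend f v) (λ u → extend f u v) ⟨
    ∑[ w < n ] weight f v w   ∎
    where open ≈-Reasoning

  weight-sym : ∀ f u v → weight f u v ≈ weight f v u
  weight-sym f u v = +-comm _ _

  load-linear : ∀ f t g v → load (λ e → f e + t * g e) v ≈ load f v + t * load g v
  load-linear f t g v = begin
    load (λ e → f e + t * g e) v                 ≈⟨ load≈∑weight (λ e → f e + t * g e) v ⟩
    ∑[ w < n ] weight (λ e → f e + t * g e) v w  ≈⟨ sum-cong-≋ (λ w → trans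
                                                      (+-cong (extend-linear f t g v w) (extend-linear f t g w v))
                                                      (solve 5 (λ t a b c d → (a :+ t :* b) :+ (c :+ t :* d) := (a :+ c) :+ t :* (b :+ d))
                                                        refl t (extend f v w) (extend g v w) (extend f w v) (extend g w v))) ⟩
    ∑[ w < n ] (weight f v w + t * weight g v w) ≈⟨ ∑-linear t (weight f v) (weight g v) ⟩
    ∑[ w < n ] weight f v w + t * ∑[ w < n ] weight g v w
                                                 ≈⟨ +-cong (load≈∑weight f v) (*-congˡ (load≈∑weight g v)) ⟨
    load f v + t * load g v                      ∎
    where open ≈-Reasoning

  handshake : ∀ f → ∑[ v < n ] load f v ≈ edgeSum G f + edgeSum G f
  handshake f = begin
    ∑[ v < n ] load f v
      ≈⟨ sum-cong-≋ (λ v → trans (load≈∑weight f v) (∑-distrib-+ (extend f v) (λ w → extend f w v))) ⟩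
    ∑[ v < n ] (∑[ w < n ] extend f v w + ∑[ w < n ] extend f w v)
      ≈⟨ ∑-distrib-+ (λ v → ∑[ w < n ] extend f v w) (λ v → ∑[ w < n ] extend f w v) ⟩
    edgeSum G f + ∑[ v < n ] ∑[ w < n ] extend f w v
      ≈⟨ +-congˡ (∑-comm (λ v w → extend f w v)) ⟩
    edgeSum G f + edgeSum G f   ∎
    where open ≈-Reasoning

  extend-nonNeg : ∀ {f} → (∀ e → 0# ≤ f e) → ∀ u v → 0# ≤ extend f u v
  extend-nonNeg 0≤f u v with isEdge? G u v
  ... | yes uv = 0≤f (edge u v uv)
  ... | no _   = ≤-refl

  -- Makes the upper bound 1 on edge values a consequence of the vertex constraints, so a perturbed
  -- matching needs checking only for signs and loads.
  value≤load : ∀ {f} → (∀ e → 0# ≤ f e) → ∀ e → f e ≤ load f (Edge.end₁ e)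
  value≤load {f} 0≤f (edge u v uv) = begin
    f (edge u v uv)           ≡⟨ extend-edge f uv ⟨
    extend f u v              ≈⟨ +-identityʳ _ ⟨
    extend f u v + 0#         ≤⟨ +-monoʳ-≤ _ (extend-nonNeg 0≤f v u) ⟩
    weight f u v              ≤⟨ term≤∑ (λ w → +-nonNeg (extend-nonNeg 0≤f u w) (extend-nonNeg 0≤f w u)) v ⟩
    ∑[ w < n ] weight f u w   ≈⟨ load≈∑weight f u ⟨
    load f u                  ∎
    where open ≤-Reasoning

  weight-pos⇒adjacent : ∀ f {u v} → 0# < weight f u v → adj G u v ≡ true
  weight-pos⇒adjacent f {u} {v} 0<uv with isEdge? G u v | isEdge? G v u
  ... | yes (_ , uv) | _            = uv
  ... | no _         | yes (_ , vu) = ≡.trans (adj-sym G u v) vu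
  ... | no _         | no _         = contradiction 0<uv (<-irrefl (sym (+-identityˡ 0#)))

  unit : Fin n → Fin n → EdgeFunction
  unit p q e = [ p ≡ Edge.end₁ e ] * [ q ≡ Edge.end₂ e ]

  extend-unit : ∀ {p q} → IsEdge G p q → ∀ u v → extend (unit p q) u v ≈ [ p ≡ u ] * [ q ≡ v ]
  extend-unit {p} {q} pq u v with isEdge? G u v
  ... | yes _  = refl
  ... | no ¬uv with p Fin.≟ u | q Fin.≟ v
  ...   | yes ≡.refl | yes ≡.refl = contradiction pq ¬uv
  ...   | yes _ | no _  = sym (zeroʳ _)
  ...   | no _  | yes _ = sym (zeroˡ _)
  ...   | no _  | no _  = sym (zeroˡ _)

  ∑-[≡] : ∀ i → ∑[ j < n ] [ i ≡ j ] ≈ 1#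
  ∑-[≡] i = trans (sum-cong-≋ (λ j → sym (*-identityʳ [ i ≡ j ]))) (∑-kronecker i (λ _ → 1#))

  load-unit : ∀ {p q} → IsEdge G p q → ∀ x → load (unit p q) x ≈ [ p ≡ x ] + [ q ≡ x ]
  load-unit {p} {q} pq x = begin
    load (unit p q) x                                              ≈⟨ load≈∑weight (unit p q) x ⟩
    ∑[ w < n ] weight (unit p q) x w                               ≈⟨ sum-cong-≋ (λ w → +-cong (extend-unit pq x w)
                                                                        (trans (extend-unit pq w x) (*-comm _ _))) ⟩
    ∑[ w < n ] ([ p ≡ x ] * [ q ≡ w ] + [ q ≡ x ] * [ p ≡ w ])     ≈⟨ ∑-linear [ q ≡ x ] (λ w → [ p ≡ x ] * [ q ≡ w ]) [ p ≡_] ⟩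
    ∑[ w < n ] ([ p ≡ x ] * [ q ≡ w ]) + [ q ≡ x ] * ∑[ w < n ] [ p ≡ w ]
      ≈⟨ +-cong (trans (sym (*-distribˡ-sum [ p ≡ x ] [ q ≡_])) (*-congˡ (∑-[≡] q))) (*-congˡ (∑-[≡] p)) ⟩
    [ p ≡ x ] * 1# + [ q ≡ x ] * 1#                                ≈⟨ +-cong (*-identityʳ _) (*-identityʳ _) ⟩
    [ p ≡ x ] + [ q ≡ x ]                                          ∎
    where open ≈-Reasoning

  -- The change of an edge function along the edge between v and w,
  -- whichever of the two endpoints comes first.
  record EdgeDirection (f : EdgeFunction) (v w : Fin n) : Set (c ⊔ ℓ₁ ⊔ ℓ₂) where
    field
      direction : EdgeFunction
      nonNeg    : ∀ e → 0# ≤ direction e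
      support   : ∀ e → direction e ≈ 0# ⊎ f e ≈ weight f v w
      balance   : ∀ x → load direction x ≈ [ v ≡ x ] + [ w ≡ x ]

  unit-nonNeg : ∀ p q e → 0# ≤ unit p q e
  unit-nonNeg p q e = *-nonNeg (when-1-nonNeg (p Fin.≟ Edge.end₁ e)) (when-1-nonNeg (q Fin.≟ Edge.end₂ e))

  unit-support : ∀ f {p q} → IsEdge G p q → ∀ e → unit p q e ≈ 0# ⊎ f e ≈ weight f p q
  unit-support f {p} {q} pq (edge u v uv) with p Fin.≟ u | q Fin.≟ v
  ... | yes ≡.refl | yes ≡.refl = inj₂ (begin
    f (edge u v uv)               ≡⟨ extend-edge f uv ⟨
    extend f u v                  ≈⟨ +-identityʳ _ ⟨
    extend f u v + 0#             ≡⟨ ≡.cong (λ y → extend f u v + y) (extend-nonEdge f λ (v<u , _) → Fin.<-asym (proj₁ uv) v<u) ⟨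
    weight f u v                  ∎)
    where open ≈-Reasoning
  ... | yes _ | no _  = inj₁ (zeroʳ _)
  ... | no _  | yes _ = inj₁ (zeroˡ _)
  ... | no _  | no _  = inj₁ (zeroˡ _)

  edgeDirection : ∀ f {v w} → adj G v w ≡ true → EdgeDirection f v w
  edgeDirection f {v} {w} v~w with Fin.<-cmp v w
  ... | tri≈ _ ≡.refl _ with () ← ≡.trans (≡.sym v~w) (adj-irrefl G v)
  ... | tri< v<w _ _ = record
    { direction = unit v w
    ; nonNeg    = unit-nonNeg v w
    ; support   = unit-support f (v<w , v~w)
    ; balance   = load-unit (v<w , v~w)
    }
  ... | tri> _ _ w<v = record
    { direction = unit w v
    ; nonNeg    = unit-nonNeg w v
    ; support   = λ e → [ inj₁ , (λ eq → inj₂ (trans eq (weight-sym f w v))) ]′ (unit-support f wv e)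
    ; balance   = λ x → trans (load-unit wv x) (+-comm _ _)
    }
    where wv = w<v , ≡.trans (adj-sym G w v) v~w

  card : (Fin n → Bool) → Carrier
  card a = ∑[ v < n ] 𝟙 (a v)

  -- Even and odd alternating walks from an unsaturated vertex u, recorded
  -- only through the change of loads obtained by alternately raising and
  -- lowering the edges of the walk.
  module AlternatingWalks (f : EdgeFunction) (f-matching : IsFractionalMatching G f)
                          (f-maximal : ∀ g → IsFractionalMatching G g → edgeSum G g ≤ edgeSum G f) where

    open IsFractionalMatching f-matching

    Unsaturated : Fin n → Set ℓ₂
    Unsaturated u = load f u < 1#

    -- The condition under which f + t g stays nonnegative for small t: g may be negative only where
    -- f is positive.
    Admissible : EdgeFunction → Set (ℓ₁ ⊔ ℓ₂)
    Admissible g = ∀ e → 0# ≤ g e ⊎ 0# < f e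

    record Even (v : Fin n) : Set (c ⊔ ℓ₁ ⊔ ℓ₂) where
      constructor evenWalk
      field
        root       : Fin n
        unsat      : Unsaturated root
        change     : EdgeFunction
        admissible : Admissible change
        balance    : ∀ x → load change x ≈ [ root ≡ x ] - [ v ≡ x ]

    record Odd (w : Fin n) : Set (c ⊔ ℓ₁ ⊔ ℓ₂) where
      constructor oddWalk
      field
        root       : Fin n
        unsat      : Unsaturated root
        change     : EdgeFunction
        admissible : Admissible change
        balance    : ∀ x → load change x ≈ [ root ≡ x ] + [ w ≡ x ]

    saturated : ∀ v → ¬ Unsaturated v → load f v ≈ 1#
    saturated v sat = ≤-antisym (atVertex v) (≮⇒≥ sat)

    +-admissible : ∀ {g h} → Admissible g → Admissible h → Admissible (λ e → g e + 1# * h e)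
    +-admissible adm-g adm-h e with adm-g e | adm-h e
    ... | inj₁ 0≤g | inj₁ 0≤h = inj₁ (+-nonNeg 0≤g (*-nonNeg 0≤1 0≤h))
    ... | inj₁ _   | inj₂ 0<f = inj₂ 0<f
    ... | inj₂ 0<f | _        = inj₂ 0<f

    unsaturated⇒even : ∀ u → Unsaturated u → Even u
    unsaturated⇒even u unsat = evenWalk u unsat (λ _ → 0#) (λ _ → inj₁ ≤-refl) λ x → begin
      load (λ _ → 0#) x                       ≈⟨ sum-cong-≋ (λ v → trans (sum-cong-≋ (zero-extend x v)) (sum-replicate-zero n)) ⟩
      ∑[ v < n ] 0#                           ≈⟨ sum-replicate-zero n ⟩
      0#                                      ≈⟨ -‿inverseʳ _ ⟨
      [ u ≡ x ] - [ u ≡ x ]                   ∎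
      where
      open ≈-Reasoning
      zero-extend : ∀ x v w → extend (λ e → when (incident? x e) λ _ → 0#) v w ≈ 0#
      zero-extend x v w with isEdge? G v w
      ... | no _ = refl
      ... | yes vw with incident? x (edge {G = G} v w vw)
      ...   | yes _ = refl
      ...   | no _  = refl

    -- Raising the edge v w restores the load that v lost and adds one at w. Raising is always
    -- admissible.
    even⇒odd : ∀ {v w} → adj G v w ≡ true → Even v → Odd w
    even⇒odd {v} {w} v~w (evenWalk u unsat g adm bal) =
      oddWalk u unsat (λ e → g e + 1# * direction e) (+-admissible adm λ e → inj₁ (nonNeg e)) λ x → begin
        load (λ e → g e + 1# * direction e) x                  ≈⟨ load-linear g 1# direction x ⟩
        load g x + 1# * load direction x                       ≈⟨ +-cong (bal x) (*-congˡ (balance x)) ⟩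
        ([ u ≡ x ] - [ v ≡ x ]) + 1# * ([ v ≡ x ] + [ w ≡ x ])
          ≈⟨ solve 3 (λ a b c → (a :- b) :+ con (+ 1) :* (b :+ c) := a :+ c) refl [ u ≡ x ] [ v ≡ x ] [ w ≡ x ] ⟩
        [ u ≡ x ] + [ w ≡ x ]                                  ∎
      where
      open EdgeDirection (edgeDirection f v~w)
      open ≈-Reasoning

    -- Lowering the edge v w takes back the load gained at v and removes one at w. This is
    -- admissible because f is positive on that edge and g is left unchanged on all others.
    odd⇒even : ∀ {v w} → 0# < weight f v w → Odd v → Even w
    odd⇒even {v} {w} 0<vw (oddWalk u unsat g adm bal) =
      evenWalk u unsat (λ e → g e + - 1# * direction e) admissible λ x → begin
        load (λ e → g e + - 1# * direction e) x                  ≈⟨ load-linear g (- 1#) direction x ⟩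
        load g x + - 1# * load direction x                       ≈⟨ +-cong (bal x) (*-congˡ (balance x)) ⟩
        ([ u ≡ x ] + [ v ≡ x ]) + - 1# * ([ v ≡ x ] + [ w ≡ x ])
          ≈⟨ solve 3 (λ a b c → (a :+ b) :+ (:- con (+ 1)) :* (b :+ c) := a :- c) refl [ u ≡ x ] [ v ≡ x ] [ w ≡ x ] ⟩
        [ u ≡ x ] - [ w ≡ x ]                                    ∎
      where
      open EdgeDirection (edgeDirection f (weight-pos⇒adjacent f {v} {w} 0<vw))
      open ≈-Reasoning
      admissible : Admissible (λ e → g e + - 1# * direction e)
      admissible e with adm e | support e
      ... | inj₂ 0<f | _         = inj₂ 0<f
      ... | inj₁ _   | inj₂ f≈vw = inj₂ (<-respʳ-≈ (sym f≈vw) 0<vw)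
      ... | inj₁ 0≤g | inj₁ d≈0  = inj₁ (≤-respʳ-≈ (begin
        g e                        ≈⟨ solve 1 (λ g → g := g :+ (:- con (+ 1)) :* con (+ 0)) refl (g e) ⟩
        g e + - 1# * 0#            ≈⟨ +-congˡ (*-congˡ d≈0) ⟨
        g e + - 1# * direction e   ∎) 0≤g)

    -- For small t > 0, f + t g is again a fractional matching: loads change only at u and u′, which
    -- have slack. The loads of g add up to 2, so by `handshake` the total grows, against
    -- maximality. The vertices u and u′ may coincide, which covers closed odd walks.
    ¬augmenting : ∀ u u′ {g} → Unsaturated u → Unsaturated u′ → Admissible g →
                  ¬ (∀ x → load g x ≈ [ u ≡ x ] + [ u′ ≡ x ])
    ¬augmenting u u′ {g} unsat unsat′ adm bal =
      ≤⇒≯ (f-maximal f+tg matching) (<-respʳ-≈ (sym (edgeSum-linear f t g))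
        (0<y-x⇒x<y (<-respʳ-≈ (solve 2 (λ x y → y := (x :+ y) :- x) refl (edgeSum G f) (t * edgeSum G g))
                     (*-pos 0<t 0<g))))
      where
      EdgesOK VerticesOK : Carrier → Set (ℓ₁ ⊔ ℓ₂)
      EdgesOK t    = ∀ v w (vw : IsEdge G v w) → 0# ≤ f (edge v w vw) + t * g (edge v w vw)
      VerticesOK t = ∀ x → 0# ≤ (1# - load f x) + t * (- load g x)

      edgesOK : Eventually EdgesOK
      edgesOK = eventually-∀ λ v → eventually-∀ λ w → atPair v w
        where
        atPair : ∀ v w → Eventually (λ t → ∀ vw → 0# ≤ f (edge v w vw) + t * g (edge v w vw))
        atPair v w with isEdge? G v w
        ... | no ¬vw = always λ _ _ vw → contradiction vw ¬vw
        ... | yes vw with ε , 0<ε , h ← eventually-+* (nonneg (edge v w vw)) (adm (edge v w vw)) =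
          ε , 0<ε , λ t 0<t t≤ε vw′ →
            ≡.subst (λ p → 0# ≤ f (edge v w p) + t * g (edge v w p)) (IsEdge-irrelevant vw vw′) (h t 0<t t≤ε)

      verticesOK : Eventually VerticesOK
      verticesOK = eventually-∀ λ x → eventually-+* (x≤y⇒0≤y-x (atVertex x)) (slack x)
        where
        -- An unsaturated vertex has room for a change of either sign; a saturated one is neither u
        -- nor u′, so g leaves its load unchanged.
        slack : ∀ x → 0# ≤ - load g x ⊎ 0# < 1# - load f x
        slack x with load f x <? 1#
        ... | yes x-unsat = inj₂ (x<y⇒0<y-x x-unsat)
        ... | no  x-sat with u Fin.≟ x | u′ Fin.≟ x | bal x
        ...   | yes ≡.refl | _          | _ = contradiction unsat x-sat
        ...   | no _       | yes ≡.refl | _ = contradiction unsat′ x-sat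
        ...   | no _       | no _       | b = inj₁ (inj₂ (trans
          (solve 0 (con (+ 0) := :- (con (+ 0) :+ con (+ 0))) refl) (-‿cong (sym b))))

      step : ∃[ t ] 0# < t × EdgesOK t × VerticesOK t
      step = witness (eventually-× edgesOK verticesOK)

      t = proj₁ step
      0<t = proj₁ (proj₂ step)

      f+tg : EdgeFunction
      f+tg e = f e + t * g e

      f+tg-nonNeg : ∀ e → 0# ≤ f+tg e
      f+tg-nonNeg (edge v w vw) = proj₁ (proj₂ (proj₂ step)) v w vw

      f+tg-atVertex : ∀ x → load f+tg x ≤ 1#
      f+tg-atVertex x = 0≤y-x⇒x≤y (≤-respʳ-≈ (trans
        (solve 3 (λ l t m → (con (+ 1) :- l) :+ t :* (:- m) := con (+ 1) :- (l :+ t :* m)) refl (load f x) t (load g x))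
        (+-congˡ (-‿cong (sym (load-linear f t g x))))) (proj₂ (proj₂ (proj₂ step)) x))

      matching : IsFractionalMatching G f+tg
      matching = record
        { nonneg   = f+tg-nonNeg
        ; ≤-one    = λ e → ≤-trans (value≤load f+tg-nonNeg e) (f+tg-atVertex (Edge.end₁ e))
        ; atVertex = f+tg-atVertex
        }

      2g≈2 : edgeSum G g + edgeSum G g ≈ 1# + 1#
      2g≈2 = begin
        edgeSum G g + edgeSum G g                       ≈⟨ handshake g ⟨
        ∑[ x < n ] load g x                             ≈⟨ sum-cong-≋ bal ⟩
        ∑[ x < n ] ([ u ≡ x ] + [ u′ ≡ x ])             ≈⟨ ∑-distrib-+ [ u ≡_] [ u′ ≡_] ⟩
        ∑[ x < n ] [ u ≡ x ] + ∑[ x < n ] [ u′ ≡ x ]    ≈⟨ +-cong (∑-[≡] u) (∑-[≡] u′) ⟩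
        1# + 1#                                         ∎
        where open ≈-Reasoning

      0<g : 0# < edgeSum G g
      0<g = ≰⇒> λ g≤0 → ≤⇒≯ (≤-respʳ-≈ (+-identityˡ 0#) (≤-respˡ-≈ 2g≈2 (+-mono-≤ g≤0 g≤0)))
                            0<1+1

    odd⇒saturated : ∀ {w} → Odd w → load f w ≈ 1#
    odd⇒saturated {w} (oddWalk u unsat g adm bal) = saturated w λ w-unsat → ¬augmenting u w unsat w-unsat adm bal

    -- Joining the two walks at v cancels the change there and raises the load at both roots.
    even∧odd : ∀ {v} → Even v → ¬ Odd v
    even∧odd {v} (evenWalk u unsat g adm bal) (oddWalk u′ unsat′ h adm′ bal′) =
      ¬augmenting u u′ unsat unsat′ (+-admissible adm adm′) λ x → begin
        load (λ e → g e + 1# * h e) x                            ≈⟨ load-linear g 1# h x ⟩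
        load g x + 1# * load h x                                 ≈⟨ +-cong (bal x) (*-congˡ (bal′ x)) ⟩
        ([ u ≡ x ] - [ v ≡ x ]) + 1# * ([ u′ ≡ x ] + [ v ≡ x ])
          ≈⟨ solve 3 (λ a b c → (a :- b) :+ con (+ 1) :* (c :+ b) := a :+ c) refl [ u ≡ x ] [ v ≡ x ] [ u′ ≡ x ] ⟩
        [ u ≡ x ] + [ u′ ≡ x ]                                   ∎
      where open ≈-Reasoning

    weight-nonNeg : ∀ v w → 0# ≤ weight f v w
    weight-nonNeg v w = +-nonNeg (extend-nonNeg nonneg v w) (extend-nonNeg nonneg w v)

    -- Along an edge of positive weight, v is even exactly when w is odd, by `even⇒odd` and
    -- `odd⇒even`; elsewhere both sides vanish. Summed over all pairs, this equates the total load
    -- of the even vertices with that of the odd ones.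
    weight-even-odd : (even? : ∀ v → Dec (Even v)) (odd? : ∀ v → Dec (Odd v)) → ∀ v w →
                      𝟙 (does (even? v)) * weight f v w ≈ 𝟙 (does (odd? w)) * weight f w v
    weight-even-odd even? odd? v w with weight-nonNeg v w
    ... | inj₂ 0≈vw = trans (trans (*-congˡ (sym 0≈vw)) (zeroʳ _))
                            (sym (trans (*-congˡ (trans (weight-sym f w v) (sym 0≈vw))) (zeroʳ _)))
    ... | inj₁ 0<vw with even? v | odd? w
    ...   | yes _      | yes _     = *-congˡ (weight-sym f v w)
    ...   | no ¬even-v | yes odd-w = contradiction (odd⇒even {w} {v} (<-respʳ-≈ (weight-sym f v w) 0<vw) odd-w) ¬even-v
    ...   | no _       | no _      = trans (zeroˡ _) (sym (zeroˡ _))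
    ...   | yes even-v | no ¬odd-w = contradiction (even⇒odd (weight-pos⇒adjacent f {v} {w} 0<vw) even-v) ¬odd-w

    -- The even vertices form a and the odd ones b. Vertices outside a have load 1, so |a| + 2m is n
    -- plus the total load of a, where m is the size of f. That load equals the total load of b,
    -- which is |b| because odd vertices are saturated.
    deficiency : ¬ ¬ (∃[ a ] ∃[ b ]
      (∀ v w → a v ≡ true → adj G v w ≡ true → b w ≡ true) ×
      (∀ v → a v ≡ true → ¬ (b v ≡ true)) ×
      card a + (edgeSum G f + edgeSum G f) ≈ card b + ι n)
    deficiency k = ¬¬-dec-∀ λ even? → ¬¬-dec-∀ λ odd? → k
      ( (λ v → does (even? v))
      , (λ w → does (odd? w))
      , (λ v w a-v v~w → dec-true (odd? w) (even⇒odd v~w (does-sound (even? v) a-v)))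
      , (λ v a-v b-v → even∧odd (does-sound (even? v) a-v) (does-sound (odd? v) b-v))
      , count even? odd? )
      where
      does-sound : ∀ {p} {P : Set p} (d : Dec P) → does d ≡ true → P
      does-sound (yes p) _ = p

      module _ (even? : ∀ v → Dec (Even v)) (odd? : ∀ v → Dec (Odd v)) where
        a b : Fin n → Bool
        a v = does (even? v)
        b v = does (odd? v)

        -- An unsaturated vertex is even by the empty walk, so a vertex outside a has load 1.
        even-load : ∀ v → 𝟙 (a v) + load f v ≈ 𝟙 (a v) * load f v + 1#
        even-load v with even? v
        ... | yes _      = trans (+-comm _ _) (+-congʳ (sym (*-identityˡ _)))
        ... | no ¬even-v = +-cong (sym (zeroˡ _)) (saturated v λ v-unsat → ¬even-v (unsaturated⇒even v v-unsat))

        odd-load : ∀ w → 𝟙 (b w) * load f w ≈ 𝟙 (b w)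
        odd-load w with odd? w
        ... | yes odd-w = trans (*-identityˡ _) (odd⇒saturated odd-w)
        ... | no _      = zeroˡ _

        𝟙*load : ∀ (a : Fin n → Bool) v → 𝟙 (a v) * load f v ≈ ∑[ w < n ] (𝟙 (a v) * weight f v w)
        𝟙*load a v = trans (*-congˡ (load≈∑weight f v)) (*-distribˡ-sum (𝟙 (a v)) (weight f v))

        count : card a + (edgeSum G f + edgeSum G f) ≈ card b + ι n
        count = begin
          card a + (edgeSum G f + edgeSum G f)                       ≈⟨ +-congˡ (handshake f) ⟨
          card a + ∑[ v < n ] load f v                               ≈⟨ ∑-distrib-+ (λ v → 𝟙 (a v)) (load f) ⟨
          ∑[ v < n ] (𝟙 (a v) + load f v)                            ≈⟨ sum-cong-≋ even-load ⟩
          ∑[ v < n ] (𝟙 (a v) * load f v + 1#)                       ≈⟨ ∑-distrib-+ (λ v → 𝟙 (a v) * load f v) (λ _ → 1#) ⟩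
          ∑[ v < n ] (𝟙 (a v) * load f v) + ∑[ v < n ] 1#            ≈⟨ +-cong (sum-cong-≋ (𝟙*load a)) (sum-replicate n) ⟩
          ∑[ v < n ] ∑[ w < n ] (𝟙 (a v) * weight f v w) + ι n       ≈⟨ +-congʳ (sum-cong-≋ (λ v → sum-cong-≋ (weight-even-odd even? odd? v))) ⟩
          ∑[ v < n ] ∑[ w < n ] (𝟙 (b w) * weight f w v) + ι n       ≈⟨ +-congʳ (∑-comm (λ v w → 𝟙 (b w) * weight f w v)) ⟩
          ∑[ w < n ] ∑[ v < n ] (𝟙 (b w) * weight f w v) + ι n       ≈⟨ +-congʳ (sum-cong-≋ (λ w → trans (sym (𝟙*load b w)) (odd-load w))) ⟩
          card b + ι n                                               ∎
          where open ≈-Reasoning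

-- The form of D + A as a sum of squares over the edges.

module SignlessLaplacian {c ℓ₁ ℓ₂ : Level} (ℝ : Reals c ℓ₁ ℓ₂) {n : ℕ} (H : Graph n) where

  open OrderedField ℝ
  open QuadraticForms ℝ

  signlessLaplacian : Matrix {n}
  signlessLaplacian i j = degreeMatrix H i j + adjacencyMatrix H i j

  ι-∣tabulate∣ : ∀ {m} (p : Fin m → Bool) → ι ∣ tabulate p ∣ˢ ≈ ∑[ i < m ] 𝟙 (p i)
  ι-∣tabulate∣ {zero}  p = refl
  ι-∣tabulate∣ {suc m} p with p zero
  ... | true  = +-congˡ (ι-∣tabulate∣ (λ i → p (suc i)))
  ... | false = trans (ι-∣tabulate∣ (λ i → p (suc i))) (sym (+-identityˡ _))

  ι-degree : ∀ v → ι (degree H v) ≈ ∑[ w < n ] adjacencyMatrix H v w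
  ι-degree v = ι-∣tabulate∣ (adj H v)

  adjacency-sym : Symmetric (adjacencyMatrix H)
  adjacency-sym i j = reflexive (≡.cong 𝟙 (adj-sym H i j))

  signlessLaplacian-sym : Symmetric signlessLaplacian
  signlessLaplacian-sym i j = +-cong degree-sym (adjacency-sym i j)
    where
    degree-sym : degreeMatrix H i j ≈ degreeMatrix H j i
    degree-sym with i Fin.≟ j | j Fin.≟ i
    ... | yes ≡.refl | yes _   = refl
    ... | no _       | no _    = refl
    ... | yes i≡j    | no j≢i  = contradiction (≡.sym i≡j) j≢i
    ... | no i≢j     | yes j≡i = contradiction (≡.sym j≡i) i≢j

  signlessLaplacian-· : ∀ x i → (signlessLaplacian · x) i ≈ ∑[ j < n ] (adjacencyMatrix H i j * (x i + x j))
  signlessLaplacian-· x i = begin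
    ∑[ j < n ] ((degreeMatrix H i j + A i j) * x j)
      ≈⟨ sum-cong-≋ (λ j → trans (distribʳ _ _ _) (+-congʳ (diagonal j))) ⟩
    ∑[ j < n ] (ι (degree H i) * ([ i ≡ j ] * x j) + A i j * x j)
      ≈⟨ ∑-distrib-+ (λ j → ι (degree H i) * ([ i ≡ j ] * x j)) (λ j → A i j * x j) ⟩
    ∑[ j < n ] (ι (degree H i) * ([ i ≡ j ] * x j)) + ∑[ j < n ] (A i j * x j)
      ≈⟨ +-congʳ (trans (sym (*-distribˡ-sum (ι (degree H i)) (λ j → [ i ≡ j ] * x j))) (*-congˡ (∑-kronecker i x))) ⟩
    ι (degree H i) * x i + ∑[ j < n ] (A i j * x j)
      ≈⟨ +-congʳ (trans (*-comm _ _) (trans (*-congˡ (ι-degree i)) (*-distribˡ-sum (x i) (A i)))) ⟩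
    ∑[ j < n ] (x i * A i j) + ∑[ j < n ] (A i j * x j)
      ≈⟨ ∑-distrib-+ (λ j → x i * A i j) (λ j → A i j * x j) ⟨
    ∑[ j < n ] (x i * A i j + A i j * x j)
      ≈⟨ sum-cong-≋ (λ j → solve 3 (λ a x y → x :* a :+ a :* y := a :* (x :+ y)) refl (A i j) (x i) (x j)) ⟩
    ∑[ j < n ] (A i j * (x i + x j))   ∎
    where
    open ≈-Reasoning
    A = adjacencyMatrix H
    diagonal : ∀ j → degreeMatrix H i j * x j ≈ ι (degree H i) * ([ i ≡ j ] * x j)
    diagonal j with i Fin.≟ j
    ... | yes _ = *-congˡ (sym (*-identityˡ _))
    ... | no _  = solve 2 (λ d x → con (+ 0) :* x := d :* (con (+ 0) :* x)) refl (ι (degree H i)) (x j)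

  edgeForm : (Fin n → Carrier) → Carrier
  edgeForm x = ∑[ u < n ] ∑[ v < n ] (adjacencyMatrix H u v * ((x u + x v) * (x u + x v)))

  -- Every edge is counted from both ends.
  2form≈edgeForm : ∀ x → ⟪ x , signlessLaplacian · x ⟫ + ⟪ x , signlessLaplacian · x ⟫ ≈ edgeForm x
  2form≈edgeForm x = begin
    F + F                                             ≈⟨ +-cong F≈ F≈ ⟩
    ∑[ u < n ] ∑[ v < n ] T u v + ∑[ u < n ] ∑[ v < n ] T u v
                                                      ≈⟨ ∑∑-symmetrise T ⟨
    ∑[ u < n ] ∑[ v < n ] (T u v + T v u)             ≈⟨ sum-cong-≋ (λ u → sum-cong-≋ (T+T u)) ⟩
    edgeForm x                                        ∎
    where
    open ≈-Reasoning
    A = adjacencyMatrix H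
    F = ⟪ x , signlessLaplacian · x ⟫
    T : Fin n → Fin n → Carrier
    T u v = x u * (A u v * (x u + x v))
    F≈ : F ≈ ∑[ u < n ] ∑[ v < n ] T u v
    F≈ = sum-cong-≋ λ u → trans (*-congˡ (signlessLaplacian-· x u)) (*-distribˡ-sum (x u) (λ v → A u v * (x u + x v)))
    T+T : ∀ u v → T u v + T v u ≈ A u v * ((x u + x v) * (x u + x v))
    T+T u v = trans (+-congˡ (*-congˡ (*-congʳ (adjacency-sym v u))))
      (solve 3 (λ a x y → x :* (a :* (x :+ y)) :+ y :* (a :* (y :+ x)) := a :* ((x :+ y) :* (x :+ y))) refl (A u v) (x u) (x v))

  edgeForm≤ : ∀ {q} → IsQIndex H q → ∀ x → edgeForm x ≤ q * ⟪ x , x ⟫ + q * ⟪ x , x ⟫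
  edgeForm≤ q-index x = ≤-respˡ-≈ (2form≈edgeForm x) (+-mono-≤ h h)
    where h = rayleigh signlessLaplacian-sym q-index x

-- Lower bounds on the two Q-indices from the sets a and b.

module SpectralBounds {c ℓ₁ ℓ₂ : Level} (ℝ : Reals c ℓ₁ ℓ₂) {n : ℕ} (G : Graph n)
              (a b : Fin n → Bool)
              (a-nbr : ∀ v w → a v ≡ true → adj G v w ≡ true → b w ≡ true)
              (a-b-disjoint : ∀ v → a v ≡ true → ¬ (b v ≡ true)) where

  open OrderedField ℝ
  open QuadraticForms ℝ
  open FractionalMatchings ℝ G using (card)
  open SignlessLaplacian ℝ using (edgeForm; edgeForm≤; ι-degree; adjacency-sym)

  card-nonNeg : ∀ p → 0# ≤ card p
  card-nonNeg p = ∑-nonNeg λ v → 𝟙-nonNeg (p v)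

  card-disjoint : card a + card b ≤ ι n
  card-disjoint = ≤-respˡ-≈ (∑-distrib-+ (λ v → 𝟙 (a v)) (λ v → 𝟙 (b v)))
    (≤-respʳ-≈ (sum-replicate n) (∑-mono pointwise))
    where
    pointwise : ∀ v → 𝟙 (a v) + 𝟙 (b v) ≤ 1#
    pointwise v with a v in av | b v in bv
    ... | true  | true  = contradiction bv (a-b-disjoint v av)
    ... | true  | false = inj₂ (+-identityʳ 1#)
    ... | false | true  = inj₂ (+-identityˡ 1#)
    ... | false | false = ≤-respˡ-≈ (sym (+-identityˡ 0#)) 0≤1

  norm-𝟙 : ⟪ (λ v → 𝟙 (a v)) , (λ v → 𝟙 (a v)) ⟫ ≈ card a
  norm-𝟙 = sum-cong-≋ idempotent
    where
    idempotent : ∀ v → 𝟙 (a v) * 𝟙 (a v) ≈ 𝟙 (a v)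
    idempotent v with a v
    ... | true  = *-identityˡ 1#
    ... | false = zeroˡ 0#

  module _ {δ : ℕ} (δ-min : ∀ v → δ ℕ.≤ degree G v) where

    edgesOut : Carrier
    edgesOut = ∑[ u < n ] ∑[ v < n ] (𝟙 (a u) * adjacencyMatrix G u v)

    δ*card≤edgesOut : card a * ι δ ≤ edgesOut
    δ*card≤edgesOut = begin
      card a * ι δ                                       ≈⟨ trans (*-comm _ _) (*-distribˡ-sum (ι δ) (λ u → 𝟙 (a u))) ⟩
      ∑[ u < n ] (ι δ * 𝟙 (a u))                         ≤⟨ ∑-mono (λ u → ≤-respˡ-≈ (*-comm _ _) (*-monoˡ-≤ (𝟙-nonNeg (a u)) (ι-mono (δ-min u)))) ⟩
      ∑[ u < n ] (𝟙 (a u) * ι (degree G u))              ≈⟨ sum-cong-≋ (λ u → trans (*-congˡ (ι-degree G u))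
                                                              (*-distribˡ-sum (𝟙 (a u)) (adjacencyMatrix G u))) ⟩
      edgesOut                                           ∎
      where open ≤-Reasoning

    -- Every neighbour of a vertex of a lies in b. The edges leaving a are counted instead of
    -- choosing one vertex, so that `0# < card a` can be used as it stands: |a| δ ≤ edges ≤ |a| |b|.
    δ≤card : 0# < card a → ι δ ≤ card b
    δ≤card 0<a = *-cancelˡ-≤ 0<a (begin
      card a * ι δ                                   ≤⟨ δ*card≤edgesOut ⟩
      edgesOut                                       ≤⟨ ∑-mono (λ u → ∑-mono (toB u)) ⟩
      ∑[ u < n ] ∑[ v < n ] (𝟙 (a u) * 𝟙 (b v))      ≈⟨ sum-cong-≋ (λ u → trans (sym (*-distribˡ-sum (𝟙 (a u)) (λ v → 𝟙 (b v)))) (*-comm _ _)) ⟩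
      ∑[ u < n ] (card b * 𝟙 (a u))                  ≈⟨ trans (sym (*-distribˡ-sum (card b) (λ u → 𝟙 (a u)))) (*-comm _ _) ⟩
      card a * card b                                ∎)
      where
      open ≤-Reasoning
      toB : ∀ u v → 𝟙 (a u) * adjacencyMatrix G u v ≤ 𝟙 (a u) * 𝟙 (b v)
      toB u v with a u in au | adj G u v in uv
      ... | false | _     = inj₂ (trans (zeroˡ _) (sym (zeroˡ _)))
      ... | true  | false = *-monoˡ-≤ 0≤1 (𝟙-nonNeg (b v))
      ... | true  | true  = *-monoˡ-≤ 0≤1 (inj₂ (reflexive (≡.cong 𝟙 (≡.sym (a-nbr u v au uv)))))

    -- The test vector takes the value |b| on a and |a| on b, so that its two
    -- values add up to |a| + |b| along every edge between a and b.
    bipartite-bound : ∀ {q} → IsQIndex G q →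
      (card b + card a) * (card b + card a) * (card a * ι δ) ≤
      q * (card b * card b * card a + card a * card a * card b)
    bipartite-bound {q} q-index = 2-cancel-≤ (begin
      t * (card a * ι δ) + t * (card a * ι δ)        ≤⟨ +-mono-≤ h h ⟩
      t * edgesOut + t * edgesOut                    ≈⟨ sums ⟩
      ∑[ u < n ] ∑[ v < n ] (t * (𝟙 (a u) * A u v + 𝟙 (a v) * A v u))
                                                     ≤⟨ ∑-mono (λ u → ∑-mono (pointwise u)) ⟩
      edgeForm G x                                   ≤⟨ edgeForm≤ G q-index x ⟩
      q * ⟪ x , x ⟫ + q * ⟪ x , x ⟫                  ≈⟨ +-cong (*-congˡ norm) (*-congˡ norm) ⟩
      q * (s * s * r + r * r * s) + q * (s * s * r + r * r * s)   ∎)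
      where
      open ≤-Reasoning
      A = adjacencyMatrix G
      s = card b
      r = card a
      t = (s + r) * (s + r)
      h = *-monoˡ-≤ (sq-nonNeg (s + r)) δ*card≤edgesOut
      x : Fin n → Carrier
      x v = s * 𝟙 (a v) + r * 𝟙 (b v)

      norm : ⟪ x , x ⟫ ≈ s * s * r + r * r * s
      norm = trans (sum-cong-≋ square) (trans (∑-linear (r * r) (λ v → s * s * 𝟙 (a v)) (λ v → 𝟙 (b v)))
                   (+-congʳ (sym (*-distribˡ-sum (s * s) (λ v → 𝟙 (a v))))))
        where
        square : ∀ v → x v * x v ≈ s * s * 𝟙 (a v) + r * r * 𝟙 (b v)
        square v with a v in av | b v in bv
        ... | true  | true  = contradiction bv (a-b-disjoint v av)
        ... | true  | false = solve 2 (λ s r → (s :* con (+ 1) :+ r :* con (+ 0)) :* (s :* con (+ 1) :+ r :* con (+ 0))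
                                            := s :* s :* con (+ 1) :+ r :* r :* con (+ 0)) refl s r
        ... | false | true  = solve 2 (λ s r → (s :* con (+ 0) :+ r :* con (+ 1)) :* (s :* con (+ 0) :+ r :* con (+ 1))
                                            := s :* s :* con (+ 0) :+ r :* r :* con (+ 1)) refl s r
        ... | false | false = solve 2 (λ s r → (s :* con (+ 0) :+ r :* con (+ 0)) :* (s :* con (+ 0) :+ r :* con (+ 0))
                                            := s :* s :* con (+ 0) :+ r :* r :* con (+ 0)) refl s r

      sums : t * edgesOut + t * edgesOut ≈ ∑[ u < n ] ∑[ v < n ] (t * (𝟙 (a u) * A u v + 𝟙 (a v) * A v u))
      sums = trans (sym (distribˡ t edgesOut edgesOut))
        (trans (*-congˡ (sym (∑∑-symmetrise (λ u v → 𝟙 (a u) * A u v))))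
               (∑∑-distribˡ t (λ u v → 𝟙 (a u) * A u v + 𝟙 (a v) * A v u)))

      -- No edge has both ends in a, since its second end would also lie in b. An edge with one end
      -- in a has the other in b and gives equality; for any other pair the left side is 0.
      edge-bound : ∀ u v → t * (𝟙 (a u) * A u v + 𝟙 (a v) * A u v) ≤ A u v * ((x u + x v) * (x u + x v))
      edge-bound u v with adj G u v in uv | a u in au | b u in bu | a v in av | b v in bv
      ... | false | a-u   | b-u   | a-v   | b-v   = inj₂
        (solve 4 (λ t p q y → t :* (p :* con (+ 0) :+ q :* con (+ 0)) := con (+ 0) :* y) refl
          t (𝟙 a-u) (𝟙 a-v) _)
      ... | true  | false | b-u   | false | b-v   = ≤-respˡ-≈
        (solve 1 (λ t → con (+ 0) := t :* (con (+ 0) :* con (+ 1) :+ con (+ 0) :* con (+ 1))) refl t)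
        (*-nonNeg 0≤1 (sq-nonNeg _))
      ... | true  | true  | _     | true  | _     = contradiction (a-nbr u v au uv) (a-b-disjoint v av)
      ... | true  | true  | true  | false | _     = contradiction bu (a-b-disjoint u au)
      ... | true  | false | _     | true  | true  = contradiction bv (a-b-disjoint v av)
      ... | true  | true  | false | false | false with () ← ≡.trans (≡.sym bv) (a-nbr u v au uv)
      ... | true  | false | false | true  | false with () ← ≡.trans (≡.sym bu) (a-nbr v u av (≡.trans (adj-sym G v u) uv))
      ... | true  | true  | false | false | true  = inj₂ (solve 2 (λ s r →
        let z = con (+ 0); i = con (+ 1); y = (s :* i :+ r :* z) :+ (s :* z :+ r :* i)
        in (s :+ r) :* (s :+ r) :* (i :* i :+ z :* i) := i :* (y :* y)) refl s r)
      ... | true  | false | true  | true  | false = inj₂ (solve 2 (λ s r →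
        let z = con (+ 0); i = con (+ 1); y = (s :* z :+ r :* i) :+ (s :* i :+ r :* z)
        in (s :+ r) :* (s :+ r) :* (z :* i :+ i :* i) := i :* (y :* y)) refl s r)

      pointwise : ∀ u v → t * (𝟙 (a u) * A u v + 𝟙 (a v) * A v u) ≤ A u v * ((x u + x v) * (x u + x v))
      pointwise u v = ≤-respˡ-≈ (*-congˡ (+-congˡ (*-congˡ (adjacency-sym G u v)))) (edge-bound u v)

  -- The form is a sum of squares, and the indicator of a is a nonzero test vector. This settles the
  -- degenerate case of empty b.
  qIndex-nonNeg : ∀ {q} → 0# < card a → IsQIndex G q → 0# ≤ q
  qIndex-nonNeg {q} 0<a q-index = *-cancelˡ-≤ 0<a (≤-respˡ-≈ (sym (zeroʳ _)) (2-cancel-≤ (begin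
    0# + 0#                              ≈⟨ +-identityˡ 0# ⟩
    0#                                   ≤⟨ ∑-nonNeg (λ u → ∑-nonNeg λ v → *-nonNeg (𝟙-nonNeg (adj G u v)) (sq-nonNeg _)) ⟩
    edgeForm G x                         ≤⟨ edgeForm≤ G q-index x ⟩
    q * ⟪ x , x ⟫ + q * ⟪ x , x ⟫        ≈⟨ +-cong norm norm ⟩
    card a * q + card a * q              ∎)))
    where
    open ≤-Reasoning
    x : Fin n → Carrier
    x v = 𝟙 (a v)
    norm = trans (*-congˡ norm-𝟙) (*-comm q (card a))

  -- In the complement, a is a clique; the test vector is its indicator.
  clique-bound : ∀ {q} → IsQIndex (complement G) q →
                 (card a - 1#) * card a + (card a - 1#) * card a ≤ q * card a
  clique-bound {q} q-index = 2-cancel-≤ (begin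
    (y + y) + (y + y)                                     ≈⟨ sums ⟨
    ∑[ u < n ] ∑[ v < n ] (4# * (𝟙 (a u) * 𝟙 (a v) + - 1# * ([ u ≡ v ] * 𝟙 (a v))))
                                                          ≤⟨ ∑-mono (λ u → ∑-mono (pointwise u)) ⟩
    edgeForm (complement G) x                             ≤⟨ edgeForm≤ (complement G) q-index x ⟩
    q * ⟪ x , x ⟫ + q * ⟪ x , x ⟫                         ≈⟨ +-cong (*-congˡ norm-𝟙) (*-congˡ norm-𝟙) ⟩
    q * card a + q * card a                               ∎)
    where
    open ≤-Reasoning
    x : Fin n → Carrier
    x v = 𝟙 (a v)
    y = (card a - 1#) * card a
    -- The value of (x u + x v)² when both ends lie in a. The terms with `[ u ≡ v ]` remove the
    -- diagonal, where the complement has no edge.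
    4# = (1# + 1#) * (1# + 1#)

    row : ∀ u → ∑[ v < n ] (𝟙 (a u) * 𝟙 (a v) + - 1# * ([ u ≡ v ] * 𝟙 (a v))) ≈ (card a - 1#) * 𝟙 (a u)
    row u = begin-equality
      ∑[ v < n ] (𝟙 (a u) * 𝟙 (a v) + - 1# * ([ u ≡ v ] * 𝟙 (a v)))
        ≈⟨ ∑-linear (- 1#) (λ v → 𝟙 (a u) * 𝟙 (a v)) (λ v → [ u ≡ v ] * 𝟙 (a v)) ⟩
      ∑[ v < n ] (𝟙 (a u) * 𝟙 (a v)) + - 1# * ∑[ v < n ] ([ u ≡ v ] * 𝟙 (a v))
        ≈⟨ +-cong (sym (*-distribˡ-sum (𝟙 (a u)) x)) (*-congˡ (∑-kronecker u x)) ⟩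
      𝟙 (a u) * card a + - 1# * 𝟙 (a u)
        ≈⟨ solve 2 (λ p r → p :* r :+ (:- con (+ 1)) :* p := (r :- con (+ 1)) :* p) refl (𝟙 (a u)) (card a) ⟩
      (card a - 1#) * 𝟙 (a u)   ∎

    sums : ∑[ u < n ] ∑[ v < n ] (4# * (𝟙 (a u) * 𝟙 (a v) + - 1# * ([ u ≡ v ] * 𝟙 (a v)))) ≈ (y + y) + (y + y)
    sums = begin-equality
      ∑[ u < n ] ∑[ v < n ] (4# * (𝟙 (a u) * 𝟙 (a v) + - 1# * ([ u ≡ v ] * 𝟙 (a v))))
        ≈⟨ ∑∑-distribˡ 4# (λ u v → 𝟙 (a u) * 𝟙 (a v) + - 1# * ([ u ≡ v ] * 𝟙 (a v))) ⟨
      4# * ∑[ u < n ] ∑[ v < n ] (𝟙 (a u) * 𝟙 (a v) + - 1# * ([ u ≡ v ] * 𝟙 (a v)))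
        ≈⟨ *-congˡ (trans (sum-cong-≋ row) (sym (*-distribˡ-sum (card a - 1#) x))) ⟩
      4# * y
        ≈⟨ solve 1 (λ y → (con (+ 1) :+ con (+ 1)) :* (con (+ 1) :+ con (+ 1)) :* y := (y :+ y) :+ (y :+ y)) refl y ⟩
      (y + y) + (y + y)   ∎

    pointwise : ∀ u v → 4# * (𝟙 (a u) * 𝟙 (a v) + - 1# * ([ u ≡ v ] * 𝟙 (a v))) ≤
                        adjacencyMatrix (complement G) u v * ((x u + x v) * (x u + x v))
    pointwise u v with a v in av
    ... | false = ≤-respˡ-≈
      (solve 3 (λ t p d → con (+ 0) := t :* (p :* con (+ 0) :+ (:- con (+ 1)) :* (d :* con (+ 0)))) refl
        4# (𝟙 (a u)) [ u ≡ v ])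
      (*-nonNeg (𝟙-nonNeg (adj (complement G) u v)) (sq-nonNeg _))
    ... | true with a u in au | u Fin.≟ v
    ...   | false | yes ≡.refl with () ← ≡.trans (≡.sym au) av
    ...   | false | no _ = ≤-respˡ-≈
      (solve 1 (λ t → con (+ 0) := t :* (con (+ 0) :* con (+ 1) :+ (:- con (+ 1)) :* (con (+ 0) :* con (+ 1)))) refl 4#)
      (*-nonNeg (𝟙-nonNeg (not (adj G u v) ∧ true)) (sq-nonNeg _))
    ...   | true  | u≟v with adj G u v in uv
    ...     | true = contradiction (a-nbr u v au uv) (a-b-disjoint v av)
    ...     | false with u≟v
    ...       | yes _ = inj₂ (solve 2
      (λ t y → t :* (con (+ 1) :* con (+ 1) :+ (:- con (+ 1)) :* (con (+ 1) :* con (+ 1))) := con (+ 0) :* y) refl 4# _)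
    ...       | no _  = inj₂ (solve 0
      (let i = con (+ 1) in (i :+ i) :* (i :+ i) :* (i :* i :+ (:- i) :* (con (+ 0) :* i)) := i :* ((i :+ i) :* (i :+ i))) refl)

  module _ {δ : ℕ} {k : Carrier} (δ-min : ∀ v → δ ℕ.≤ degree G v) (0<k : 0# < k)
           (k<n : k < ι n) (b+k≤a : card b + k ≤ card a) where

    private
      N = ι n
      Δ = ι δ
      s = card b
      r = card a

    0<r : 0# < r
    0<r = <-≤-trans (+-nonNeg-pos (card-nonNeg b) 0<k) b+k≤a

    0<d : 0# < N - k
    0<d = x<y⇒0<y-x k<n

    0≤Δ : 0# ≤ Δ
    0≤Δ = ι-mono {i = 0} {j = δ} ℕ.z≤n

    2s≤d : s + s ≤ N - k
    2s≤d = 0≤y-x⇒x≤y (≤-respʳ-≈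
      (solve 4 (λ N k s r → (N :- (r :+ s)) :+ (r :- (s :+ k)) := (N :- k) :- (s :+ s)) refl N k s r)
      (+-nonNeg (x≤y⇒0≤y-x card-disjoint) (x≤y⇒0≤y-x b+k≤a)))

    module _ {q : Carrier} (q-index : IsQIndex G q) where

      0<r[s+r] : 0# < r * (s + r)
      0<r[s+r] = *-pos 0<r (+-nonNeg-pos (card-nonNeg b) 0<r)

      -- `bipartite-bound` with its common factor r (s + r) cancelled. The factor s is kept on the
      -- right, since b may be empty.
      Δ[s+r]≤qs : Δ * (s + r) ≤ q * s
      Δ[s+r]≤qs = *-cancelˡ-≤ 0<r[s+r] (begin
        r * (s + r) * (Δ * (s + r))
          ≈⟨ solve 3 (λ r s Δ → r :* (s :+ r) :* (Δ :* (s :+ r)) := (s :+ r) :* (s :+ r) :* (r :* Δ)) refl r s Δ ⟩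
        (s + r) * (s + r) * (r * Δ)
          ≤⟨ bipartite-bound δ-min q-index ⟩
        q * (s * s * r + r * r * s)
          ≈⟨ solve 3 (λ r s q → q :* (s :* s :* r :+ r :* r :* s) := r :* (s :+ r) :* (q :* s)) refl r s q ⟩
        r * (s + r) * (q * s)   ∎)
        where open ≤-Reasoning

      -- By s + r ≥ 2s + k, the right side is at least (N - k)(2s + k) = 2sN + k (N - k - 2s), and
      -- the last term is nonnegative by `2s≤d`.
      2sN≤d[s+r] : (1# + 1#) * (s * N) ≤ (N - k) * (s + r)
      2sN≤d[s+r] = 0≤y-x⇒x≤y (≤-respʳ-≈
        (solve 4 (λ N k s r →
            (N :- k) :* (r :- (s :+ k)) :+ k :* ((N :- k) :- (s :+ s))
            := (N :- k) :* (s :+ r) :- (con (+ 1) :+ con (+ 1)) :* (s :* N))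
          refl N k s r)
        (+-nonNeg (*-nonNeg (inj₁ 0<d) (x≤y⇒0≤y-x b+k≤a)) (*-nonNeg (inj₁ 0<k) (x≤y⇒0≤y-x 2s≤d))))

      qIndex-bound : (ι 2 * Δ * N) / (N - k) ≤ q
      qIndex-bound with 0# <? s
      ... | yes 0<s = *-cancelˡ-≤ 0<d (≤-respˡ-≈ (sym (/-cancel 0<d _)) (*-cancelˡ-≤ 0<s (begin
        s * (ι 2 * Δ * N)
          -- `ι 2` unfolds to `1# + (1# + 0#)`, a shape that the solver expression has to reproduce.
          ≈⟨ solve 3 (λ s Δ N → let i = con (+ 1) in
               s :* ((i :+ (i :+ con (+ 0))) :* Δ :* N) := Δ :* ((i :+ i) :* (s :* N))) refl s Δ N ⟩
        Δ * ((1# + 1#) * (s * N))        ≤⟨ *-monoˡ-≤ 0≤Δ 2sN≤d[s+r] ⟩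
        Δ * ((N - k) * (s + r))          ≈⟨ solve 3 (λ Δ d t → Δ :* (d :* t) := d :* (Δ :* t)) refl Δ (N - k) (s + r) ⟩
        (N - k) * (Δ * (s + r))          ≤⟨ *-monoˡ-≤ (inj₁ 0<d) Δ[s+r]≤qs ⟩
        (N - k) * (q * s)                ≈⟨ solve 3 (λ d q s → d :* (q :* s) := s :* (d :* q)) refl (N - k) q s ⟩
        s * ((N - k) * q)                ∎)))
        where open ≤-Reasoning
      -- If b is empty then δ = 0 by `δ≤card`, and the bound degenerates to 0 ≤ q.
      ... | no  s≯0 = begin
        (ι 2 * Δ * N) / (N - k)   ≈⟨ *-congʳ (*-congʳ (*-congˡ Δ≈0)) ⟩
        (ι 2 * 0# * N) / (N - k)
          ≈⟨ solve 3 (λ t N d → t :* con (+ 0) :* N :* d := con (+ 0)) refl (ι 2) N ((N - k) ⁻¹) ⟩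
        0#                        ≤⟨ qIndex-nonNeg 0<r q-index ⟩
        q                         ∎
        where
        open ≤-Reasoning
        Δ≈0 : Δ ≈ 0#
        Δ≈0 = ≤-antisym (≤-trans (δ≤card δ-min 0<r) (≮⇒≥ s≯0)) 0≤Δ

    -- `clique-bound` divided by r gives q ≥ 2(r - 1), and r ≥ s + k ≥ δ + k.
    complement-qIndex-bound : ∀ {q} → IsQIndex (complement G) q → ι 2 * (Δ + k - 1#) ≤ q
    complement-qIndex-bound {q} q-index = ≤-trans
      (0≤y-x⇒x≤y (≤-respʳ-≈
        (solve 4 (λ s r k Δ → let i = con (+ 1); h = (s :- Δ) :+ (r :- (s :+ k)) in
            h :+ h := (i :+ i) :* (r :- i) :- (i :+ (i :+ con (+ 0))) :* ((Δ :+ k) :- i)) refl s r k Δ)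
        (+-nonNeg 0≤h 0≤h)))
      (*-cancelˡ-≤ 0<r (≤-respʳ-≈ (*-comm q r) (≤-respˡ-≈
        (solve 1 (λ r → let i = con (+ 1) in
          (r :- i) :* r :+ (r :- i) :* r := r :* ((i :+ i) :* (r :- i))) refl r)
        (clique-bound q-index))))
      where
      0≤h = +-nonNeg (x≤y⇒0≤y-x (δ≤card δ-min 0<r)) (x≤y⇒0≤y-x b+k≤a)

-- Playing the deficiency off against the spectral bounds.

corollary1p5 : ∀ {c ℓ₁ ℓ₂} (ℝ : Reals c ℓ₁ ℓ₂) →
    let open Reals ℝ
        open OverReals ℝ
    in
    ∀ {n : ℕ} (G : Graph n) (δ : ℕ) (k : Carrier) →
    Connected G →
    IsMinDegree G δ →
    0# < k → k < ι n →
    ι δ ≤ (ι n - k) / ι 2 →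
    (∀ q₁ μf → IsQIndex G q₁ → IsFractionalMatchingNumber G μf →
      q₁ < (ι 2 * ι δ * ι n) / (ι n - k) →
      (ι n - k) / ι 2 < μf)
    ×
    (∀ q₁ᶜ μf → IsQIndex (complement G) q₁ᶜ → IsFractionalMatchingNumber G μf →
      q₁ᶜ < ι 2 * (ι δ + k - 1#) →
      (ι n - k) / ι 2 < μf)
corollary1p5 ℝ {n} G δ k _ (_ , δ-min) 0<k k<n _ =
  (λ q μ q-index μ-number q< → fromDeficiency μ-number λ a b nbr disj b+k≤a →
    ≤⇒≯ (SpectralBounds.qIndex-bound ℝ G a b nbr disj δ-min 0<k k<n b+k≤a q-index) q<) ,
  (λ q μ q-index μ-number q< → fromDeficiency μ-number λ a b nbr disj b+k≤a →
    ≤⇒≯ (SpectralBounds.complement-qIndex-bound ℝ G a b nbr disj δ-min 0<k k<n b+k≤a q-index) q<)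
  where
  open OrderedField ℝ
  open FractionalMatchings ℝ G using (card; module AlternatingWalks)

  -- The order is decidable, so it is enough to refute the case μ ≤ (n - k)/2. The goal there is
  -- absurd, which is what lets the doubly negated `deficiency` be used.
  fromDeficiency : ∀ {μ} → IsFractionalMatchingNumber G μ →
    (∀ a b → (∀ v w → a v ≡ true → adj G v w ≡ true → b w ≡ true) → (∀ v → a v ≡ true → ¬ (b v ≡ true)) →
      card b + k ≤ card a → ⊥) →
    (ι n - k) / ι 2 < μ
  fromDeficiency {μ} ((f , f-matching , μ≈f) , μ-max) refute with (ι n - k) / ι 2 <? μ
  ... | yes <μ = <μ
  ... | no  ≮μ = contradiction
    (λ (a , b , nbr , disj , count) → refute a b nbr disj (surplus count))
    (AlternatingWalks.deficiency f f-matching λ g g-matching → ≤-respʳ-≈ μ≈f (μ-max g g-matching))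
    where
    m = edgeSum G f

    2m≤n-k : m + m ≤ ι n - k
    2m≤n-k = begin
      m + m                     ≤⟨ +-mono-≤ (≤-respˡ-≈ μ≈f (≮⇒≥ ≮μ)) (≤-respˡ-≈ μ≈f (≮⇒≥ ≮μ)) ⟩
      (ι n - k) / ι 2 + (ι n - k) / ι 2
        ≈⟨ solve 1 (λ x → x :+ x := (con (+ 1) :+ (con (+ 1) :+ con (+ 0))) :* x) refl ((ι n - k) / ι 2) ⟩
      ι 2 * ((ι n - k) / ι 2)   ≈⟨ /-cancel (+-nonNeg-pos 0≤1 (<-respʳ-≈ (sym (+-identityʳ 1#)) 0<1)) (ι n - k) ⟩
      ι n - k                   ∎
      where open ≤-Reasoning

    surplus : ∀ {r s} → r + (m + m) ≈ s + ι n → s + k ≤ r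
    surplus {r} {s} count = 0≤y-x⇒x≤y (≤-respʳ-≈ (begin
      (ι n - k) - (m + m)
        ≈⟨ solve 4 (λ N k M s → (N :- k) :- M := (s :+ N) :- M :- (s :+ k)) refl (ι n) k (m + m) s ⟩
      (s + ι n) - (m + m) - (s + k)        ≈⟨ +-congʳ (+-congʳ count) ⟨
      (r + (m + m)) - (m + m) - (s + k)    ≈⟨ +-congʳ (solve 2 (λ r M → (r :+ M) :- M := r) refl r (m + m)) ⟩
      r - (s + k)                          ∎) (x≤y⇒0≤y-x 2m≤n-k))
      where open ≈-Reasoning
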